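{- Let $b\geq0$ be an integer. Introducing the first-order linear partial differential operators $$D^{\mathrm{str}}=\frac{\partial}{\partial\hat x_1}-\sum_{\ell=0}^\infty\hat x_\ell\left(-\ell\frac{\partial}{\partial\hat x_\ell}+\sum_{k=1}^\ell2k\frac{\partial}{\partial\hat x_k}-\sum_{k=1}^b2k\frac{\partial}{\partial\hat x_k}\right),$$ $$D^{\mathrm{dil}}=\frac{\partial}{\partial\hat x_1}-\frac{\partial}{\partial\hat x_0}-\sum_{\ell=0}^\infty\hat x_\ell\frac{\partial}{\partial\hat x_\ell},$$ we have $$D^{\mathrm{str}}\check R^{(b)}=1+\check R^{(b)},\qquad D^{\mathrm{dil}}\check R^{(b)}=0.$$
   Context: Define the formal power series in $r$ $$I(b,\ell;r)=\sum_{p=0}^\infty\frac{r^p}{(p!)^2}\prod_{m=0}^{p-1}(\ell^2-(b-m)^2),\qquad J(b;r)=\sum_{p=1}^\infty\frac{(-1)^{p+1}r^p}{p!(p-1)!}\prod_{m=0}^{p-2}(b-m)(b-m-1),$$ and $\check Z^{(b)}(r;\hat x_0,\hat x_1,\ldots)=J(b;r)-\sum_{\ell=0}^\infty I(b,\ell;r)\hat x_\ell$. $\check R^{(b)}(\hat x_0,\hat x_1,\ldots)$ is the unique formal power series with zero constant term satisfying $\check Z^{(b)}(\check R^{(b)};\hat x_0,\hat x_1,\ldots)=0$. -}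

module Defs where

open import Data.Integer as ℤ using (ℤ)
open import Data.List using (List; []; _∷_; length; foldr; applyUpTo)
open import Data.Nat as ℕ using (ℕ; zero; suc; _∸_; _!; _≤_; _<_; s≤s; z≤n; _⊔_)
open import Data.Nat.ListAction using (sum)
import Data.Nat.Properties as ℕₚ
open import Data.Rational using (ℚ; 0ℚ; 1ℚ; _/_; _+_; _*_; _-_; -_)
import Data.Rational.Properties as ℚₚ
open import Function using (_∘_)
open import Relation.Binary.PropositionalEquality using (_≡_; refl; sym; trans; cong; cong₂; module ≡-Reasoning)

∑ : ℕ → (ℕ → ℚ) → ℚ
∑ n f = foldr _+_ 0ℚ (applyUpTo f n)

∏ℤ : ℕ → (ℕ → ℤ) → ℤ
∏ℤ n f = foldr ℤ._*_ (ℤ.+ 1) (applyUpTo f n)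

∑-cong : ∀ n {f g : ℕ → ℚ} → (∀ i → f i ≡ g i) → ∑ n f ≡ ∑ n g
∑-cong zero    h = refl
∑-cong (suc n) h = cong₂ _+_ (h 0) (∑-cong n (h ∘ suc))

∑-zero : ∀ n {f : ℕ → ℚ} → (∀ i → f i ≡ 0ℚ) → ∑ n f ≡ 0ℚ
∑-zero zero    h = refl
∑-zero (suc n) h = trans (cong₂ _+_ (h 0) (∑-zero n (h ∘ suc))) (ℚₚ.+-identityˡ 0ℚ)

∑-extend : ∀ {m n} {f : ℕ → ℚ} → m ≤ n → (∀ i → m ≤ i → f i ≡ 0ℚ) → ∑ n f ≡ ∑ m f
∑-extend {n = n} z≤n     h = ∑-zero n (λ i → h i z≤n)
∑-extend {f = f} (s≤s p) h = cong (f 0 +_) (∑-extend p (λ i q → h (suc i) (s≤s q)))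

------------------------------------------------------------------------
-- Monomials in x₀, x₁, x₂, …

-- The list e₀ ∷ e₁ ∷ … ∷ eₙ ∷ [] stands for x₀^e₀ x₁^e₁ ⋯ xₙ^eₙ; lists that
-- differ by trailing zeros stand for the same monomial.
Mon : Set
Mon = List ℕ

exponent : Mon → ℕ → ℕ
exponent []      _       = 0
exponent (e ∷ _) zero    = e
exponent (_ ∷ α) (suc k) = exponent α k

degree : Mon → ℕ
degree = sum

infix 4 _≋_

_≋_ : Mon → Mon → Set
α ≋ β = ∀ k → exponent α k ≡ exponent β k

≋-cons : ∀ i {α β} → α ≋ β → (i ∷ α) ≋ (i ∷ β)
≋-cons i h zero    = refl
≋-cons i h (suc k) = h k

≋-sym : ∀ {α β} → α ≋ β → β ≋ α
≋-sym h k = sym (h k)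

[]≋0∷[] : [] ≋ 0 ∷ []
[]≋0∷[] zero    = refl
[]≋0∷[] (suc k) = refl

degree-≋ : ∀ α β → α ≋ β → degree α ≡ degree β
degree-≋ []      []      h = refl
degree-≋ []      (b ∷ β) h = cong₂ ℕ._+_ (h 0) (degree-≋ [] β (h ∘ suc))
degree-≋ (a ∷ α) []      h = cong₂ ℕ._+_ (h 0) (degree-≋ α [] (h ∘ suc))
degree-≋ (a ∷ α) (b ∷ β) h = cong₂ ℕ._+_ (h 0) (degree-≋ α β (h ∘ suc))

degree≡0 : ∀ α → degree α ≡ 0 → α ≋ []
degree≡0 []      _ k       = refl
degree≡0 (a ∷ α) h zero    = ℕₚ.m+n≡0⇒m≡0 a h
degree≡0 (a ∷ α) h (suc k) = degree≡0 α (ℕₚ.m+n≡0⇒n≡0 a h) k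

-- Multiplication of a monomial by xₖ.
inc : ℕ → Mon → Mon
inc zero    []      = 1 ∷ []
inc zero    (e ∷ α) = suc e ∷ α
inc (suc k) []      = 0 ∷ inc k []
inc (suc k) (e ∷ α) = e ∷ inc k α

inc-≋ : ∀ k α β → α ≋ β → inc k α ≋ inc k β
inc-≋ zero    []      []      h j       = refl
inc-≋ zero    []      (b ∷ β) h zero    = cong suc (h 0)
inc-≋ zero    []      (b ∷ β) h (suc j) = h (suc j)
inc-≋ zero    (a ∷ α) []      h zero    = cong suc (h 0)
inc-≋ zero    (a ∷ α) []      h (suc j) = h (suc j)
inc-≋ zero    (a ∷ α) (b ∷ β) h zero    = cong suc (h 0)
inc-≋ zero    (a ∷ α) (b ∷ β) h (suc j) = h (suc j)
inc-≋ (suc k) []      []      h j       = refl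
inc-≋ (suc k) []      (b ∷ β) h zero    = h 0
inc-≋ (suc k) []      (b ∷ β) h (suc j) = inc-≋ k [] β (h ∘ suc) j
inc-≋ (suc k) (a ∷ α) []      h zero    = h 0
inc-≋ (suc k) (a ∷ α) []      h (suc j) = inc-≋ k α [] (h ∘ suc) j
inc-≋ (suc k) (a ∷ α) (b ∷ β) h zero    = h 0
inc-≋ (suc k) (a ∷ α) (b ∷ β) h (suc j) = inc-≋ k α β (h ∘ suc) j

------------------------------------------------------------------------
-- The ring ℚ[[x₀, x₁, x₂, …]]

Respects : (Mon → ℚ) → Set
Respects f = ∀ α β → α ≋ β → f α ≡ f β

record Series : Set where
  constructor series
  field
    coeff   : Mon → ℚ
    coeff-≋ : Respects coeff

open Series public

infix 4 _≈_

_≈_ : Series → Series → Set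
F ≈ G = ∀ μ → coeff F μ ≡ coeff G μ

constantTerm : Series → ℚ
constantTerm F = coeff F []

constCoeff : ℚ → Mon → ℚ
constCoeff c []          = c
constCoeff c (zero ∷ α)  = constCoeff c α
constCoeff c (suc _ ∷ _) = 0ℚ

constCoeff-≋ : ∀ c → Respects (constCoeff c)
constCoeff-≋ c []          []          h = refl
constCoeff-≋ c []          (zero ∷ β)  h = constCoeff-≋ c [] β (h ∘ suc)
constCoeff-≋ c []          (suc b ∷ β) h with () ← h 0
constCoeff-≋ c (zero ∷ α)  []          h = constCoeff-≋ c α [] (h ∘ suc)
constCoeff-≋ c (suc a ∷ α) []          h with () ← h 0
constCoeff-≋ c (zero ∷ α)  (zero ∷ β)  h = constCoeff-≋ c α β (h ∘ suc)
constCoeff-≋ c (zero ∷ α)  (suc b ∷ β) h with () ← h 0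
constCoeff-≋ c (suc a ∷ α) (zero ∷ β)  h with () ← h 0
constCoeff-≋ c (suc a ∷ α) (suc b ∷ β) h = refl

const : ℚ → Series
const c = series (constCoeff c) (constCoeff-≋ c)

0ˢ 1ˢ : Series
0ˢ = const 0ℚ
1ˢ = const 1ℚ

varCoeff : ℕ → Mon → ℚ
varCoeff _       []                = 0ℚ
varCoeff zero    (zero ∷ _)        = 0ℚ
varCoeff zero    (suc zero ∷ α)    = constCoeff 1ℚ α
varCoeff zero    (suc (suc _) ∷ _) = 0ℚ
varCoeff (suc ℓ) (zero ∷ α)        = varCoeff ℓ α
varCoeff (suc ℓ) (suc _ ∷ _)       = 0ℚ

varCoeff-vanish : ∀ ℓ α → exponent α ℓ ≡ 0 → varCoeff ℓ α ≡ 0ℚ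
varCoeff-vanish ℓ       []          h = refl
varCoeff-vanish zero    (zero ∷ α)  h = refl
varCoeff-vanish (suc ℓ) (zero ∷ α)  h = varCoeff-vanish ℓ α h
varCoeff-vanish (suc ℓ) (suc a ∷ α) h = refl

varCoeff-≋ : ∀ ℓ → Respects (varCoeff ℓ)
varCoeff-≋ ℓ       []          β           h = sym (varCoeff-vanish ℓ β (sym (h ℓ)))
varCoeff-≋ ℓ       (a ∷ α)     []          h = varCoeff-vanish ℓ (a ∷ α) (h ℓ)
varCoeff-≋ ℓ       (a ∷ α)     (b ∷ β)     h with refl ← h 0 = same ℓ a
  where
  same : ∀ ℓ a → varCoeff ℓ (a ∷ α) ≡ varCoeff ℓ (a ∷ β)
  same zero    zero          = refl
  same zero    (suc zero)    = constCoeff-≋ 1ℚ α β (h ∘ suc)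
  same zero    (suc (suc _)) = refl
  same (suc ℓ) zero          = varCoeff-≋ ℓ α β (h ∘ suc)
  same (suc ℓ) (suc _)       = refl

x : ℕ → Series
x ℓ = series (varCoeff ℓ) (varCoeff-≋ ℓ)

infixl 6 _+ˢ_ _-ˢ_
infixl 7 _*ˢ_
infixr 7 _•_
infixr 8 _^ˢ_

_+ˢ_ : Series → Series → Series
F +ˢ G = series (λ μ → coeff F μ + coeff G μ) (λ α β h → cong₂ _+_ (coeff-≋ F α β h) (coeff-≋ G α β h))

_-ˢ_ : Series → Series → Series
F -ˢ G = series (λ μ → coeff F μ - coeff G μ) (λ α β h → cong₂ _-_ (coeff-≋ F α β h) (coeff-≋ G α β h))

_•_ : ℚ → Series → Series
c • F = series (λ μ → c * coeff F μ) (λ α β h → cong (c *_) (coeff-≋ F α β h))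

∑ˢ : ℕ → (ℕ → Series) → Series
∑ˢ n F = series (λ μ → ∑ n (λ i → coeff (F i) μ)) (λ α β h → ∑-cong n (λ i → coeff-≋ (F i) α β h))

-- Cauchy product, one variable at a time: λ α → f (i ∷ α) collects the
-- coefficients of x₀^i, as a series in the remaining variables.
mul : (Mon → ℚ) → (Mon → ℚ) → Mon → ℚ
mul f g []      = f [] * g []
mul f g (n ∷ μ) = ∑ (suc n) (λ i → mul (λ α → f (i ∷ α)) (λ α → g (n ∸ i ∷ α)) μ)

mul-≋ : ∀ f g → Respects f → Respects g → Respects (mul f g)
mul-≋ f g rf rg = go
  where
  rf′ : ∀ i → Respects (λ α → f (i ∷ α))
  rf′ i α β h = rf _ _ (≋-cons i h)
  rg′ : ∀ i → Respects (λ α → g (i ∷ α))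
  rg′ i α β h = rg _ _ (≋-cons i h)
  nil : ∀ β → [] ≋ β → mul f g [] ≡ mul f g β
  nil []      h = refl
  nil (b ∷ β) h with refl ← h 0 = begin
    f [] * g []                                                      ≡⟨ cong₂ _*_ (rf _ _ []≋0∷[]) (rg _ _ []≋0∷[]) ⟩
    f (0 ∷ []) * g (0 ∷ [])                                          ≡⟨ mul-≋ (λ α → f (0 ∷ α)) (λ α → g (0 ∷ α)) (rf′ 0) (rg′ 0) [] β (h ∘ suc) ⟩
    mul (λ α → f (0 ∷ α)) (λ α → g (0 ∷ α)) β                        ≡⟨ sym (ℚₚ.+-identityʳ _) ⟩
    mul (λ α → f (0 ∷ α)) (λ α → g (0 ∷ α)) β + 0ℚ                   ∎
    where open ≡-Reasoning
  go : Respects (mul f g)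
  go []      β       h = nil β h
  go (a ∷ α) []      h = sym (nil (a ∷ α) (≋-sym {a ∷ α} {[]} h))
  go (a ∷ α) (b ∷ β) h with refl ← h 0 = ∑-cong (suc a) (λ i → mul-≋ _ _ (rf′ i) (rg′ (a ∸ i)) α β (h ∘ suc))

_*ˢ_ : Series → Series → Series
F *ˢ G = series (mul (coeff F) (coeff G)) (mul-≋ _ _ (coeff-≋ F) (coeff-≋ G))

_^ˢ_ : Series → ℕ → Series
F ^ˢ zero  = 1ˢ
F ^ˢ suc p = F *ˢ (F ^ˢ p)

data Split : Mon → Mon → Mon → Set where
  []  : Split [] [] []
  _∷_ : ∀ {i j n μ α β} → i ℕ.+ j ≡ n → Split μ α β → Split (n ∷ μ) (i ∷ α) (j ∷ β)

split-exponent : ∀ {μ α β} → Split μ α β → ∀ k → exponent α k ℕ.+ exponent β k ≡ exponent μ k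
split-exponent []      k       = refl
split-exponent (e ∷ s) zero    = e
split-exponent (e ∷ s) (suc k) = split-exponent s k

split-degree : ∀ {μ α β} → Split μ α β → degree α ℕ.+ degree β ≡ degree μ
split-degree [] = refl
split-degree {α = i ∷ α} {β = j ∷ β} (refl ∷ s) = begin
  (i ℕ.+ degree α) ℕ.+ (j ℕ.+ degree β) ≡⟨ ℕₚ.+-assoc i _ _ ⟩
  i ℕ.+ (degree α ℕ.+ (j ℕ.+ degree β)) ≡⟨ cong (i ℕ.+_) (sym (ℕₚ.+-assoc (degree α) j _)) ⟩
  i ℕ.+ ((degree α ℕ.+ j) ℕ.+ degree β) ≡⟨ cong (λ t → i ℕ.+ (t ℕ.+ degree β)) (ℕₚ.+-comm (degree α) j) ⟩
  i ℕ.+ ((j ℕ.+ degree α) ℕ.+ degree β) ≡⟨ cong (i ℕ.+_) (ℕₚ.+-assoc j _ _) ⟩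
  i ℕ.+ (j ℕ.+ (degree α ℕ.+ degree β)) ≡⟨ sym (ℕₚ.+-assoc i j _) ⟩
  (i ℕ.+ j) ℕ.+ (degree α ℕ.+ degree β) ≡⟨ cong (i ℕ.+ j ℕ.+_) (split-degree s) ⟩
  (i ℕ.+ j) ℕ.+ _                       ∎
  where open ≡-Reasoning

∑-cong< : ∀ n {f g : ℕ → ℚ} → (∀ i → i < n → f i ≡ g i) → ∑ n f ≡ ∑ n g
∑-cong< zero    h = refl
∑-cong< (suc n) h = cong₂ _+_ (h 0 (s≤s z≤n)) (∑-cong< n (λ i p → h (suc i) (s≤s p)))

mul-cong : ∀ μ f g f′ g′ → (∀ {α β} → Split μ α β → f α * g β ≡ f′ α * g′ β) → mul f g μ ≡ mul f′ g′ μ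
mul-cong []      f g f′ g′ h = h []
mul-cong (n ∷ μ) f g f′ g′ h = ∑-cong< (suc n) (λ i i≤n → mul-cong μ (λ α → f (i ∷ α)) (λ α → g (n ∸ i ∷ α)) (λ α → f′ (i ∷ α)) (λ α → g′ (n ∸ i ∷ α)) (λ s → h (ℕₚ.m+[n∸m]≡n (ℕ.s≤s⁻¹ i≤n) ∷ s)))

mul-zeroˡ : ∀ μ g → mul (λ _ → 0ℚ) g μ ≡ 0ℚ
mul-zeroˡ []      g = ℚₚ.*-zeroˡ (g [])
mul-zeroˡ (n ∷ μ) g = ∑-zero (suc n) (λ i → mul-zeroˡ μ (λ α → g (n ∸ i ∷ α)))

mul-vanish : ∀ μ f g → (∀ {α β} → Split μ α β → f α * g β ≡ 0ℚ) → mul f g μ ≡ 0ℚ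
mul-vanish μ f g h = trans (mul-cong μ f g (λ _ → 0ℚ) g (λ {_} {β} s → trans (h s) (sym (ℚₚ.*-zeroˡ (g β))))) (mul-zeroˡ μ g)

exponent-beyond : ∀ μ k → length μ ≤ k → exponent μ k ≡ 0
exponent-beyond []      k       _       = refl
exponent-beyond (e ∷ μ) (suc k) (s≤s p) = exponent-beyond μ k p

x-vanish : ∀ ℓ F μ → length μ ≤ ℓ → coeff (x ℓ *ˢ F) μ ≡ 0ℚ
x-vanish ℓ F μ p = mul-vanish μ _ _ λ {α} {β} s →
  trans (cong (_* coeff F β) (varCoeff-vanish ℓ α (ℕₚ.m+n≡0⇒m≡0 _ (trans (split-exponent s ℓ) (exponent-beyond μ ℓ p)))))
        (ℚₚ.*-zeroˡ (coeff F β))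

-- The infinite sum Σ_{ℓ ≥ 0} x_ℓ F_ℓ. Only the terms with ℓ < length μ can
-- contain the monomial μ (see x-vanish).
∑xCoeff : (ℕ → Series) → Mon → ℚ
∑xCoeff F μ = ∑ (length μ) (λ ℓ → coeff (x ℓ *ˢ F ℓ) μ)

∑xCoeff-≋ : ∀ F → Respects (∑xCoeff F)
∑xCoeff-≋ F α β h = begin
  ∑ (length α) (term α) ≡⟨ sym (∑-extend (ℕₚ.m≤m⊔n (length α) (length β)) (λ ℓ → x-vanish ℓ (F ℓ) α)) ⟩
  ∑ N (term α)          ≡⟨ ∑-cong N (λ ℓ → coeff-≋ (x ℓ *ˢ F ℓ) α β h) ⟩
  ∑ N (term β)          ≡⟨ ∑-extend (ℕₚ.m≤n⊔m (length α) (length β)) (λ ℓ → x-vanish ℓ (F ℓ) β) ⟩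
  ∑ (length β) (term β) ∎
  where
  open ≡-Reasoning
  N = length α ⊔ length β
  term : Mon → ℕ → ℚ
  term μ ℓ = coeff (x ℓ *ˢ F ℓ) μ

∑x : (ℕ → Series) → Series
∑x F = series (∑xCoeff F) (∑xCoeff-≋ F)

ι : ℕ → ℚ
ι n = ℤ.+ n / 1

∂ : ℕ → Series → Series
∂ k F = series (λ μ → ι (suc (exponent μ k)) * coeff F (inc k μ))
               (λ α β h → cong₂ _*_ (cong (ι ∘ suc) (h k)) (coeff-≋ F _ _ (inc-≋ k α β h)))

-- Power series in r over ℚ[[x₀, x₁, …]]; A p is the coefficient of r^p.
Seriesʳ : Set
Seriesʳ = ℕ → Series

-- The substitution r := R, that is Σ_{p ≥ 0} A_p R^p. It is meaningful only
-- when R has zero constant term; then R^p has no monomials of degree < p, so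
-- the terms with p > degree μ do not contribute to the coefficient of μ.
eval : Seriesʳ → Series → Series
eval A R = series (λ μ → ∑ (suc (degree μ)) (λ p → coeff (A p *ˢ R ^ˢ p) μ)) resp
  where
  resp : Respects (λ μ → ∑ (suc (degree μ)) (λ p → coeff (A p *ˢ R ^ˢ p) μ))
  resp α β h rewrite degree-≋ α β h = ∑-cong (suc (degree β)) (λ p → coeff-≋ (A p *ˢ R ^ˢ p) α β h)

------------------------------------------------------------------------
-- The series I(b,ℓ;r), J(b;r) and Ž^(b)(r; x₀, x₁, …)

I-factor : ℕ → ℕ → ℕ → ℤ
I-factor b ℓ m = ℤ.+ ℓ ℤ.* ℤ.+ ℓ ℤ.- (ℤ.+ b ℤ.- ℤ.+ m) ℤ.* (ℤ.+ b ℤ.- ℤ.+ m)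

J-factor : ℕ → ℕ → ℤ
J-factor b m = (ℤ.+ b ℤ.- ℤ.+ m) ℤ.* (ℤ.+ b ℤ.- ℤ.+ m ℤ.- ℤ.+ 1)

-- I b ℓ p and J b p are the coefficients of r^p in I(b,ℓ;r) and J(b;r).
I : ℕ → ℕ → ℕ → ℚ
I b ℓ p = (∏ℤ p (I-factor b ℓ) / (p ! ℕ.* p !)) {{ p ℕₚ.!* p !≢0 }}

-- For p = q + 1 the product over 0 ≤ m ≤ p - 2 has q factors.
J : ℕ → ℕ → ℚ
J b zero      = 0ℚ
J b p@(suc q) = ((ℤ.-1ℤ ℤ.^ (p ℕ.+ 1) ℤ.* ∏ℤ q (J-factor b)) / (p ! ℕ.* q !)) {{ p ℕₚ.!* q !≢0 }}

Ž : ℕ → Seriesʳ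
Ž b p = const (J b p) -ˢ ∑x (λ ℓ → const (I b ℓ p))

record IsŘ (b : ℕ) (R : Series) : Set where
  field
    constantTerm≡0 : constantTerm R ≡ 0ℚ
    root           : eval (Ž b) R ≈ 0ˢ

open IsŘ public

------------------------------------------------------------------------
-- Existence and uniqueness of Ř^(b)

-- R ↦ R - Ž(R) is a contraction for the degree filtration, because Ž(r) has
-- constant terms 0 at r⁰ and 1 at r¹. This holds for any A of that shape.

Agree : ℕ → Series → Series → Set
Agree n F G = ∀ μ → degree μ < n → coeff F μ ≡ coeff G μ

constCoeff-0 : ∀ μ → constCoeff 0ℚ μ ≡ 0ℚ
constCoeff-0 []          = refl
constCoeff-0 (zero ∷ μ)  = constCoeff-0 μ
constCoeff-0 (suc _ ∷ μ) = refl

agree-mono : ∀ {m n F G} → m ≤ n → Agree n F G → Agree m F G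
agree-mono m≤n h μ p = h μ (ℕₚ.<-≤-trans p m≤n)

coeff-degree0 : ∀ F μ → degree μ ≡ 0 → coeff F μ ≡ constantTerm F
coeff-degree0 F μ h = coeff-≋ F μ [] (degree≡0 μ h)

mul-agreeʳ : ∀ {n} A {F G} → Agree n F G → Agree n (A *ˢ F) (A *ˢ G)
mul-agreeʳ A {F} {G} h μ p = mul-cong μ _ _ _ _ λ {α} {β} s →
  cong (coeff A α *_) (h β (ℕₚ.≤-<-trans (ℕₚ.≤-trans (ℕₚ.m≤n+m _ (degree α)) (ℕₚ.≤-reflexive (split-degree s))) p))

module _ {n : ℕ} {A F : Series} where
  private
    β<n : ∀ {μ α β d} → Split μ α β → degree μ < suc n → degree α ≡ suc d → degree β < n
    β<n {d = d} s p e = ℕₚ.<-≤-trans (ℕₚ.m<1+n⇒m≤n (s≤s (s≤s (ℕₚ.m≤n+m _ d))))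
      (ℕₚ.≤-trans (ℕₚ.≤-reflexive (trans (cong (ℕ._+ _) (sym e)) (split-degree s))) (ℕ.s≤s⁻¹ p))

  mul-agree⁺ : ∀ {G} → constantTerm A ≡ 0ℚ → Agree n F G → Agree (suc n) (A *ˢ F) (A *ˢ G)
  mul-agree⁺ {G} A₀ h μ p = mul-cong μ _ _ _ _ λ {α} {β} s → go s (degree α) refl
    where
    go : ∀ {α β} → Split μ α β → ∀ d → degree α ≡ d → coeff A α * coeff F β ≡ coeff A α * coeff G β
    go {α} {β} s zero e = trans (cong (_* coeff F β) A≡0) (trans (ℚₚ.*-zeroˡ (coeff F β))
        (sym (trans (cong (_* coeff G β) A≡0) (ℚₚ.*-zeroˡ (coeff G β)))))
      where
      A≡0 = trans (coeff-degree0 A α e) A₀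
    go {α} {β} s (suc d) e = cong (coeff A α *_) (h β (β<n s p e))

mul-comm : ∀ μ f g → mul f g μ ≡ mul g f μ
mul-comm []      f g = ℚₚ.*-comm (f []) (g [])
mul-comm (n ∷ μ) f g = trans (∑-reverse n (λ i → mul (λ α → f (i ∷ α)) (λ α → g (n ∸ i ∷ α)) μ))
  (∑-cong< (suc n) λ i p → trans
    (cong (λ k → mul (λ α → f (n ∸ i ∷ α)) (λ α → g (k ∷ α)) μ) (ℕₚ.m∸[m∸n]≡n (ℕ.s≤s⁻¹ p)))
    (mul-comm μ _ _))
  where
  open ≡-Reasoning
  ∑-last : ∀ n f → ∑ (suc n) f ≡ f n + ∑ n f
  ∑-last zero    f = refl
  ∑-last (suc n) f = begin
    f 0 + ∑ (suc n) (f ∘ suc)         ≡⟨ cong (f 0 +_) (∑-last n (f ∘ suc)) ⟩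
    f 0 + (f (suc n) + ∑ n (f ∘ suc)) ≡⟨ sym (ℚₚ.+-assoc (f 0) (f (suc n)) _) ⟩
    (f 0 + f (suc n)) + ∑ n (f ∘ suc) ≡⟨ cong (_+ ∑ n (f ∘ suc)) (ℚₚ.+-comm (f 0) (f (suc n))) ⟩
    (f (suc n) + f 0) + ∑ n (f ∘ suc) ≡⟨ ℚₚ.+-assoc (f (suc n)) (f 0) _ ⟩
    f (suc n) + (f 0 + ∑ n (f ∘ suc)) ∎
  ∑-reverse : ∀ n f → ∑ (suc n) f ≡ ∑ (suc n) (λ i → f (n ∸ i))
  ∑-reverse zero    f = refl
  ∑-reverse (suc n) f = trans (∑-last (suc n) f) (cong (f (suc n) +_) (∑-reverse n f))

*ˢ-comm : ∀ F G → F *ˢ G ≈ G *ˢ F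
*ˢ-comm F G μ = mul-comm μ (coeff F) (coeff G)

∑-+ : ∀ n (f g : ℕ → ℚ) → ∑ n (λ i → f i + g i) ≡ ∑ n f + ∑ n g
∑-+ zero    f g = refl
∑-+ (suc n) f g = begin
  (f 0 + g 0) + ∑ n (λ i → f (suc i) + g (suc i))   ≡⟨ cong (f 0 + g 0 +_) (∑-+ n (f ∘ suc) (g ∘ suc)) ⟩
  (f 0 + g 0) + (∑ n (f ∘ suc) + ∑ n (g ∘ suc))     ≡⟨ interchange (f 0) (g 0) _ _ ⟩
  (f 0 + ∑ n (f ∘ suc)) + (g 0 + ∑ n (g ∘ suc))     ∎
  where
  open ≡-Reasoning
  open import Data.Rational.Solver using (module +-*-Solver)
  open +-*-Solver
  interchange : ∀ a b c d → (a + b) + (c + d) ≡ (a + c) + (b + d)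
  interchange = solve 4 (λ a b c d → (a :+ b) :+ (c :+ d) := (a :+ c) :+ (b :+ d)) refl

mul-distribʳ : ∀ μ f g h → mul (λ α → f α + g α) h μ ≡ mul f h μ + mul g h μ
mul-distribʳ []      f g h = ℚₚ.*-distribʳ-+ (h []) (f []) (g [])
mul-distribʳ (n ∷ μ) f g h = trans
  (∑-cong (suc n) (λ i → mul-distribʳ μ (λ α → f (i ∷ α)) (λ α → g (i ∷ α)) (λ α → h (n ∸ i ∷ α))))
  (∑-+ (suc n) (λ i → mul (λ α → f (i ∷ α)) (λ α → h (n ∸ i ∷ α)) μ) (λ i → mul (λ α → g (i ∷ α)) (λ α → h (n ∸ i ∷ α)) μ))

mul-identityˡ : ∀ μ f → mul (constCoeff 1ℚ) f μ ≡ f μ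
mul-identityˡ []      f = ℚₚ.*-identityˡ (f [])
mul-identityˡ (n ∷ μ) f = trans
  (cong₂ _+_ (mul-identityˡ μ (λ α → f (n ∷ α))) (∑-zero n (λ i → mul-zeroˡ μ (λ α → f (n ∸ suc i ∷ α)))))
  (ℚₚ.+-identityʳ _)

*ˢ-identityʳ : ∀ F → F *ˢ 1ˢ ≈ F
*ˢ-identityʳ F μ = trans (*ˢ-comm F 1ˢ μ) (mul-identityˡ μ (coeff F))

*ˢ-split1 : ∀ A F → A *ˢ F ≈ F +ˢ (A -ˢ 1ˢ) *ˢ F
*ˢ-split1 A F μ = begin
  mul (coeff A) (coeff F) μ                                       ≡⟨ mul-cong μ _ _ _ _ (λ {α} {β} _ → cong (_* coeff F β) (sym (lem (constCoeff 1ℚ α) (coeff A α)))) ⟩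
  mul (λ α → constCoeff 1ℚ α + coeff (A -ˢ 1ˢ) α) (coeff F) μ     ≡⟨ mul-distribʳ μ _ _ _ ⟩
  mul (constCoeff 1ℚ) (coeff F) μ + coeff ((A -ˢ 1ˢ) *ˢ F) μ      ≡⟨ cong (_+ coeff ((A -ˢ 1ˢ) *ˢ F) μ) (mul-identityˡ μ _) ⟩
  coeff F μ + coeff ((A -ˢ 1ˢ) *ˢ F) μ                            ∎
  where
  open ≡-Reasoning
  lem : ∀ p q → p + (q - p) ≡ q
  lem p q = trans (cong (p +_) (ℚₚ.+-comm q (- p))) (trans (sym (ℚₚ.+-assoc p (- p) q))
    (trans (cong (_+ q) (ℚₚ.+-inverseʳ p)) (ℚₚ.+-identityˡ q)))

mul-agree⁺⁺ : ∀ {n F F′ G G′} → constantTerm F ≡ 0ℚ → constantTerm G′ ≡ 0ℚ →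
              Agree n F F′ → Agree n G G′ → Agree (suc n) (F *ˢ G) (F′ *ˢ G′)
mul-agree⁺⁺ {n} {F} {F′} {G} {G′} F₀ G′₀ hF hG μ p = begin
  coeff (F *ˢ G) μ   ≡⟨ mul-agree⁺ {n} {F} {G} {G′} F₀ hG μ p ⟩
  coeff (F *ˢ G′) μ  ≡⟨ *ˢ-comm F G′ μ ⟩
  coeff (G′ *ˢ F) μ  ≡⟨ mul-agree⁺ {n} {G′} {F} {F′} G′₀ hF μ p ⟩
  coeff (G′ *ˢ F′) μ ≡⟨ *ˢ-comm G′ F′ μ ⟩
  coeff (F′ *ˢ G′) μ ∎
  where open ≡-Reasoning

pow-constantTerm : ∀ R → constantTerm R ≡ 0ℚ → ∀ q → constantTerm (R ^ˢ suc q) ≡ 0ℚ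
pow-constantTerm R R₀ q = trans (cong (_* constantTerm (R ^ˢ q)) R₀) (ℚₚ.*-zeroˡ (constantTerm (R ^ˢ q)))

module Contraction (A : Seriesʳ) (A₀ : constantTerm (A 0) ≡ 0ℚ) (A₁ : constantTerm (A 1) ≡ 1ℚ) where

  step : Series → Series
  step R = R -ˢ eval A R

  eval-constantTerm : ∀ R → constantTerm (eval A R) ≡ 0ℚ
  eval-constantTerm R = trans (ℚₚ.+-identityʳ _) (trans (ℚₚ.*-identityʳ _) A₀)

  step-constantTerm : ∀ R → constantTerm R ≡ 0ℚ → constantTerm (step R) ≡ 0ℚ
  step-constantTerm R R₀ = cong₂ _-_ R₀ (eval-constantTerm R)

  module _ {n : ℕ} {R S : Series} (R₀ : constantTerm R ≡ 0ℚ) (S₀ : constantTerm S ≡ 0ℚ) (h : Agree n R S) where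

    pow-agree : ∀ q → Agree (suc n) (R ^ˢ suc (suc q)) (S ^ˢ suc (suc q))
    pow-agree¹ : ∀ q → Agree n (R ^ˢ suc q) (S ^ˢ suc q)

    pow-agree q = mul-agree⁺⁺ {n} {R} {S} {R ^ˢ suc q} {S ^ˢ suc q} R₀ (pow-constantTerm S S₀ q) h (pow-agree¹ q)
    pow-agree¹ zero    μ p = trans (*ˢ-identityʳ R μ) (trans (h μ p) (sym (*ˢ-identityʳ S μ)))
    pow-agree¹ (suc q) μ p = pow-agree q μ (ℕₚ.m<n⇒m<1+n p)

    private
      A₁-1 : constantTerm (A 1 -ˢ 1ˢ) ≡ 0ℚ
      A₁-1 = trans (cong (_- 1ℚ) A₁) (ℚₚ.+-inverseʳ 1ℚ)

      -- coefficient of A_0 + (A_1 R - R) + Σ_{p ≥ 2} A_p R^p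
      rest : Series → Mon → ℕ → ℚ
      rest F μ d = coeff (A 0 *ˢ 1ˢ) μ + (coeff ((A 1 -ˢ 1ˢ) *ˢ F ^ˢ 1) μ + ∑ d (λ p → coeff (A (2 ℕ.+ p) *ˢ F ^ˢ (2 ℕ.+ p)) μ))

      shuffle : ∀ f a b c → f - (a + ((f + b) + c)) ≡ - (a + (b + c))
      shuffle = solve 4 (λ f a b c → f :- (a :+ ((f :+ b) :+ c)) := :- (a :+ (b :+ c))) refl
        where open import Data.Rational.Solver using (module +-*-Solver)
              open +-*-Solver

      step-rest : ∀ F μ d → degree μ ≡ suc d → coeff (step F) μ ≡ - rest F μ d
      step-rest F μ d e rewrite e = trans
        (cong (λ t → coeff F μ - (coeff (A 0 *ˢ 1ˢ) μ + (t + ∑ d (λ p → coeff (A (2 ℕ.+ p) *ˢ F ^ˢ (2 ℕ.+ p)) μ))))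
          (trans (*ˢ-split1 (A 1) (F ^ˢ 1) μ) (cong (_+ coeff ((A 1 -ˢ 1ˢ) *ˢ F ^ˢ 1) μ) (*ˢ-identityʳ F μ))))
        (shuffle (coeff F μ) (coeff (A 0 *ˢ 1ˢ) μ) (coeff ((A 1 -ˢ 1ˢ) *ˢ F ^ˢ 1) μ) _)

    step-agree : Agree (suc n) (step R) (step S)
    step-agree μ p = go (degree μ) refl
      where
      go : ∀ d → degree μ ≡ d → coeff (step R) μ ≡ coeff (step S) μ
      go zero e = trans (coeff-degree0 (step R) μ e) (trans (step-constantTerm R R₀)
        (sym (trans (coeff-degree0 (step S) μ e) (step-constantTerm S S₀))))
      go (suc d) e = trans (step-rest R μ d e) (trans (cong -_ (cong (coeff (A 0 *ˢ 1ˢ) μ +_) (cong₂ _+_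
        (mul-agree⁺ {n} {A 1 -ˢ 1ˢ} {R ^ˢ 1} {S ^ˢ 1} A₁-1 (pow-agree¹ 0) μ p)
        (∑-cong d (λ q → mul-agreeʳ (A (2 ℕ.+ q)) {R ^ˢ (2 ℕ.+ q)} {S ^ˢ (2 ℕ.+ q)} (pow-agree q) μ p)))))
        (sym (step-rest S μ d e)))

  approx : ℕ → Series
  approx zero    = 0ˢ
  approx (suc n) = step (approx n)

  approx-constantTerm : ∀ n → constantTerm (approx n) ≡ 0ℚ
  approx-constantTerm zero    = refl
  approx-constantTerm (suc n) = step-constantTerm (approx n) (approx-constantTerm n)

  approx-agree : ∀ n → Agree n (approx n) (approx (suc n))
  approx-agree zero    μ ()
  approx-agree (suc n) = step-agree {n} {approx n} {approx (suc n)} (approx-constantTerm n) (approx-constantTerm (suc n)) (approx-agree n)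

  approx-agree-+ : ∀ k n → Agree n (approx n) (approx (k ℕ.+ n))
  approx-agree-+ zero    n μ p = refl
  approx-agree-+ (suc k) n μ p = trans (approx-agree-+ k n μ p) (approx-agree (k ℕ.+ n) μ (ℕₚ.<-≤-trans p (ℕₚ.m≤n+m n k)))

  limit : Series
  limit = series (λ μ → coeff (approx (suc (degree μ))) μ) resp
    where
    resp : Respects (λ μ → coeff (approx (suc (degree μ))) μ)
    resp α β h = trans (cong (λ d → coeff (approx (suc d)) α) (degree-≋ α β h)) (coeff-≋ (approx (suc (degree β))) α β h)

  limit-agree : ∀ n → Agree n limit (approx n)
  limit-agree n μ p = trans (approx-agree-+ (n ∸ suc (degree μ)) (suc (degree μ)) μ ℕₚ.≤-refl)
    (cong (λ k → coeff (approx k) μ) (ℕₚ.m∸n+n≡m p))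

  limit-constantTerm : constantTerm limit ≡ 0ℚ
  limit-constantTerm = approx-constantTerm 1

  private
    cancel : ∀ f z → f - z ≡ f → z ≡ 0ℚ
    cancel f z h = begin
      z               ≡⟨ solve 2 (λ f z → z := f :- (f :- z)) refl f z ⟩
      f - (f - z)     ≡⟨ cong (λ t → f - t) h ⟩
      f - f           ≡⟨ ℚₚ.+-inverseʳ f ⟩
      0ℚ              ∎
      where
      open ≡-Reasoning
      open import Data.Rational.Solver using (module +-*-Solver)
      open +-*-Solver

  limit-root : eval A limit ≈ 0ˢ
  limit-root μ = trans
    (cancel (coeff limit μ) (coeff (eval A limit) μ)
      (step-agree {degree μ} {limit} {approx (degree μ)} limit-constantTerm (approx-constantTerm (degree μ)) (limit-agree (degree μ)) μ ℕₚ.≤-refl))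
    (sym (constCoeff-0 μ))

  root-fixed : ∀ R → eval A R ≈ 0ˢ → step R ≈ R
  root-fixed R z μ = trans (cong (λ t → coeff R μ - t) (trans (z μ) (constCoeff-0 μ))) (ℚₚ.+-identityʳ _)

  unique : ∀ R S → constantTerm R ≡ 0ℚ → constantTerm S ≡ 0ℚ → eval A R ≈ 0ˢ → eval A S ≈ 0ˢ → R ≈ S
  unique R S R₀ S₀ zR zS μ = agree (suc (degree μ)) μ ℕₚ.≤-refl
    where
    agree : ∀ n → Agree n R S
    agree zero    ν ()
    agree (suc n) ν p = trans (sym (root-fixed R zR ν)) (trans (step-agree {n} {R} {S} R₀ S₀ (agree n) ν p) (root-fixed S zS ν))

module Ř-construction (b : ℕ) = Contraction (Ž b) refl refl

Ř : ℕ → Series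
Ř b = Ř-construction.limit b

Ř-isŘ : ∀ b → IsŘ b (Ř b)
Ř-isŘ b = record { constantTerm≡0 = Ř-construction.limit-constantTerm b ; root = Ř-construction.limit-root b }

Ř-unique : ∀ b R → IsŘ b R → R ≈ Ř b
Ř-unique b R h = Ř-construction.unique b R (Ř b) (constantTerm≡0 h) (constantTerm≡0 (Ř-isŘ b)) (root h) (root (Ř-isŘ b))

------------------------------------------------------------------------
-- The differential operators

-- Σ_{k=1}^n 2k ∂/∂x_k
∑2k∂ : ℕ → Series → Series
∑2k∂ n F = ∑ˢ n (λ i → ι (2 ℕ.* suc i) • ∂ (suc i) F)

Dstr : ℕ → Series → Series
Dstr b F = ∂ 1 F -ˢ ∑x (λ ℓ → (- ι ℓ) • ∂ ℓ F +ˢ ∑2k∂ ℓ F -ˢ ∑2k∂ b F)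

Ddil : Series → Series
Ddil F = ∂ 1 F -ˢ ∂ 0 F -ˢ ∑x (λ ℓ → ∂ ℓ F)

{-# OPTIONS --safe #-}
-- Differentiating Ž(R; x) = 0 with respect to x_k gives W ∂R/∂x_k = I(b,k;R),
-- where W = ∂Ž/∂r at r = R. Hence W D^dil R and W D^str R are combinations of
-- the I(b,k;R), which the identities
--   I(b,1) − I(b,0) = J(b),
--   (1 + r) J(b)′ − b J(b) = I(b,1),
--   (1 + r) I(b,ℓ)′ − b I(b,ℓ) = −ℓ I(b,ℓ) + Σ_{k≤ℓ} 2k I(b,k) − Σ_{k≤b} 2k I(b,k)
-- reduce to Ž(R) = 0 and (1 + R) W − b Ž(R) = (1 + R) W respectively. As W has
-- constant term 1, it can be cancelled.
module Submission where

open import Defs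
open import Data.Integer as ℤ using (ℤ)
import Data.Integer.Properties as ℤₚ
open import Data.Integer.Solver renaming (module +-*-Solver to ℤ-Solver)
open import Data.List using ([]; _∷_; length)
open import Data.Nat as ℕ using (ℕ; zero; suc; _∸_; _!; _≤_; _<_; s≤s; z≤n)
import Data.Nat.Properties as ℕₚ
open import Data.Product using (_×_; _,_)
open import Data.Rational using (ℚ; 0ℚ; 1ℚ; _/_; _+_; _*_; _-_; -_; fromℚᵘ; toℚᵘ)
import Data.Rational.Properties as ℚₚ
open import Data.Rational.Solver using (module +-*-Solver)
open import Data.Rational.Unnormalised as ℚᵘ using (mkℚᵘ; *≡*)
import Data.Rational.Unnormalised.Properties as ℚᵘₚ
open import Function using (_∘_)
open import Relation.Binary.PropositionalEquality using (_≡_; _≢_; refl; sym; trans; cong; cong₂; subst; module ≡-Reasoning)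
open import Relation.Nullary using (contradiction)
open +-*-Solver

-- The identities for I and J are proved coefficientwise by recurrences in p, cleared of
-- denominators; a factor 1 + p may be cancelled because it is positive. The third identity contains
-- sums over k of variable length. They acquire closed forms because the p-th coefficients of I(b,ℓ)
-- and I(b,ℓ+1) satisfy a two-term relation, which makes (1 + p) Σ 2k I(b,k) telescope. The
-- antidifference vanishes at ℓ = b, so subtracting Σ_{k≤b} leaves a single boundary term. Infinite
-- sums exist only as truncations chosen by the monomial: its length bounds Σ x_ℓ F_ℓ and its degree
-- bounds Σ a_p R^p. Hence products and derivatives first require both sides to be brought to a
-- common bound.

-- Arithmetic of integer fractions in ℚ.

fromℚᵘ-homo-+ : ∀ p q → fromℚᵘ (p ℚᵘ.+ q) ≡ fromℚᵘ p + fromℚᵘ q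
fromℚᵘ-homo-+ p q = ℚₚ.toℚᵘ-injective (begin
  toℚᵘ (fromℚᵘ (p ℚᵘ.+ q))                ≈⟨ ℚₚ.toℚᵘ-fromℚᵘ (p ℚᵘ.+ q) ⟩
  p ℚᵘ.+ q                                ≈⟨ ℚᵘₚ.+-cong (ℚₚ.toℚᵘ-fromℚᵘ p) (ℚₚ.toℚᵘ-fromℚᵘ q) ⟨
  toℚᵘ (fromℚᵘ p) ℚᵘ.+ toℚᵘ (fromℚᵘ q)    ≈⟨ ℚₚ.toℚᵘ-homo-+ (fromℚᵘ p) (fromℚᵘ q) ⟨
  toℚᵘ (fromℚᵘ p + fromℚᵘ q)              ∎)
  where open import Relation.Binary.Reasoning.Setoid ℚᵘₚ.≃-setoid

fromℚᵘ-homo-* : ∀ p q → fromℚᵘ (p ℚᵘ.* q) ≡ fromℚᵘ p * fromℚᵘ q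
fromℚᵘ-homo-* p q = ℚₚ.toℚᵘ-injective (begin
  toℚᵘ (fromℚᵘ (p ℚᵘ.* q))                ≈⟨ ℚₚ.toℚᵘ-fromℚᵘ (p ℚᵘ.* q) ⟩
  p ℚᵘ.* q                                ≈⟨ ℚᵘₚ.*-cong (ℚₚ.toℚᵘ-fromℚᵘ p) (ℚₚ.toℚᵘ-fromℚᵘ q) ⟨
  toℚᵘ (fromℚᵘ p) ℚᵘ.* toℚᵘ (fromℚᵘ q)    ≈⟨ ℚₚ.toℚᵘ-homo-* (fromℚᵘ p) (fromℚᵘ q) ⟨
  toℚᵘ (fromℚᵘ p * fromℚᵘ q)              ∎)
  where open import Relation.Binary.Reasoning.Setoid ℚᵘₚ.≃-setoid

open ≡-Reasoning

fromℤ : ℤ → ℚ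
fromℤ i = i / 1

-- `i / 1` is by definition `fromℚᵘ (mkℚᵘ i 0)`, so passing through unnormalised fractions avoids
-- reasoning about gcds.
fromℤ-* : ∀ i j → fromℤ (i ℤ.* j) ≡ fromℤ i * fromℤ j
fromℤ-* i j = fromℚᵘ-homo-* (mkℚᵘ i 0) (mkℚᵘ j 0)

fromℤ-+ : ∀ i j → fromℤ (i ℤ.+ j) ≡ fromℤ i + fromℤ j
fromℤ-+ i j = trans
  -- The unnormalised sum has numerator i · 1 + j · 1.
  (cong fromℤ (sym (cong₂ ℤ._+_ (ℤₚ.*-identityʳ i) (ℤₚ.*-identityʳ j))))
  (fromℚᵘ-homo-+ (mkℚᵘ i 0) (mkℚᵘ j 0))

fromℤ-neg : ∀ i → fromℤ (ℤ.- i) ≡ - fromℤ i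
fromℤ-neg i = begin
  fromℤ (ℤ.- i)                        ≡⟨ solve 2 (λ a b → b := (:- a) :+ (a :+ b)) refl (fromℤ i) (fromℤ (ℤ.- i)) ⟩
  - fromℤ i + (fromℤ i + fromℤ (ℤ.- i)) ≡⟨ cong (- fromℤ i +_) (sym (fromℤ-+ i (ℤ.- i))) ⟩
  - fromℤ i + fromℤ (i ℤ.- i)          ≡⟨ cong (λ t → - fromℤ i + fromℤ t) (ℤₚ.+-inverseʳ i) ⟩
  - fromℤ i + 0ℚ                       ≡⟨ ℚₚ.+-identityʳ _ ⟩
  - fromℤ i                            ∎

fromℤ-- : ∀ i j → fromℤ (i ℤ.- j) ≡ fromℤ i - fromℤ j
fromℤ-- i j = trans (fromℤ-+ i (ℤ.- j)) (cong (fromℤ i +_) (fromℤ-neg j))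

ι-+ : ∀ m n → ι (m ℕ.+ n) ≡ ι m + ι n
ι-+ m n = fromℤ-+ (ℤ.+ m) (ℤ.+ n)

ι-* : ∀ m n → ι (m ℕ.* n) ≡ ι m * ι n
ι-* m n = trans (cong fromℤ (ℤₚ.pos-* m n)) (fromℤ-* (ℤ.+ m) (ℤ.+ n))

ι-suc : ∀ n → ι (suc n) ≡ 1ℚ + ι n
ι-suc n = ι-+ 1 n

/-*-cancel : ∀ i d .{{_ : ℕ.NonZero d}} → (i / d) * ι d ≡ fromℤ i
/-*-cancel i (suc d) = trans (sym (fromℚᵘ-homo-* (mkℚᵘ i d) (mkℚᵘ (ℤ.+ suc d) 0)))
  (ℚₚ.fromℚᵘ-cong {mkℚᵘ i d ℚᵘ.* mkℚᵘ (ℤ.+ suc d) 0} {mkℚᵘ i 0}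
    (*≡* (trans (ℤₚ.*-identityʳ _) (cong (λ t → i ℤ.* ℤ.+ t) (sym (ℕₚ.*-identityʳ (suc d)))))))

ι-cancel : ∀ d .{{_ : ℕ.NonZero d}} {a c} → ι d * a ≡ ι d * c → a ≡ c
ι-cancel d {a} {c} h = trans (sym (lem a)) (trans (cong ((ℤ.+ 1 / d) *_) h) (lem c))
  where
  lem : ∀ a → (ℤ.+ 1 / d) * (ι d * a) ≡ a
  lem a = trans (sym (ℚₚ.*-assoc (ℤ.+ 1 / d) (ι d) a))
    (trans (cong (_* a) (/-*-cancel (ℤ.+ 1) d)) (ℚₚ.*-identityˡ a))

-- Recurrences in p for the coefficients of I(b,ℓ;r) and J(b;r).

-- `∏ℤ` unfolds at its first factor, whereas the recurrences adjoin the last one.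
∏ℤ-suc : ∀ n f → ∏ℤ (suc n) f ≡ ∏ℤ n f ℤ.* f n
∏ℤ-suc zero    f = ℤₚ.*-comm (f 0) (ℤ.+ 1)
∏ℤ-suc (suc n) f = trans (cong (f 0 ℤ.*_) (∏ℤ-suc n (f ∘ suc))) (sym (ℤₚ.*-assoc (f 0) _ _))

-- The common form of both recurrences: passing to the next coefficient multiplies the numerator by
-- k and the denominator by m.
/-suc : ∀ {i j k d e m} .{{_ : ℕ.NonZero d}} .{{_ : ℕ.NonZero e}} →
        j ≡ i ℤ.* k → e ≡ m ℕ.* d → ι m * (j / e) ≡ (i / d) * fromℤ k
/-suc {i} {j} {k} {d} {e} {m} refl refl = ι-cancel d (begin
  ι d * (ι m * (j / e))      ≡⟨ solve 3 (λ a b c → a :* (b :* c) := c :* (b :* a)) refl (ι d) (ι m) (j / e) ⟩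
  (j / e) * (ι m * ι d)      ≡⟨ cong ((j / e) *_) (sym (ι-* m d)) ⟩
  (j / e) * ι e              ≡⟨ /-*-cancel j e ⟩
  fromℤ (i ℤ.* k)            ≡⟨ fromℤ-* i k ⟩
  fromℤ i * fromℤ k          ≡⟨ cong (_* fromℤ k) (sym (/-*-cancel i d)) ⟩
  (i / d) * ι d * fromℤ k    ≡⟨ solve 3 (λ a b c → a :* b :* c := b :* (a :* c)) refl (i / d) (ι d) (fromℤ k) ⟩
  ι d * ((i / d) * fromℤ k)  ∎)

fromℤ-I-factor : ∀ b ℓ m → fromℤ (I-factor b ℓ m) ≡ ι ℓ * ι ℓ - (ι b - ι m) * (ι b - ι m)
fromℤ-I-factor b ℓ m = trans (fromℤ-- (ℤ.+ ℓ ℤ.* ℤ.+ ℓ) (b-m ℤ.* b-m)) (cong₂ _-_ (fromℤ-* (ℤ.+ ℓ) (ℤ.+ ℓ))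
  (trans (fromℤ-* b-m b-m) (cong₂ _*_ (fromℤ-- (ℤ.+ b) (ℤ.+ m)) (fromℤ-- (ℤ.+ b) (ℤ.+ m)))))
  where b-m = ℤ.+ b ℤ.- ℤ.+ m

fromℤ-J-factor : ∀ b m → fromℤ (J-factor b m) ≡ (ι b - ι m) * (ι b - ι m - 1ℚ)
fromℤ-J-factor b m = trans (fromℤ-* b-m (b-m ℤ.- ℤ.+ 1)) (cong₂ _*_ (fromℤ-- (ℤ.+ b) (ℤ.+ m))
  (trans (fromℤ-- b-m (ℤ.+ 1)) (cong (_- 1ℚ) (fromℤ-- (ℤ.+ b) (ℤ.+ m)))))
  where b-m = ℤ.+ b ℤ.- ℤ.+ m

-- Together with `I b ℓ 0`, which computes to 1, this is all that the later identities use about the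
-- products defining `I`.
I-suc : ∀ b ℓ p → (1ℚ + ι p) * (1ℚ + ι p) * I b ℓ (suc p) ≡ I b ℓ p * (ι ℓ * ι ℓ - (ι b - ι p) * (ι b - ι p))
I-suc b ℓ p = begin
  (1ℚ + ι p) * (1ℚ + ι p) * I b ℓ (suc p)  ≡⟨ cong (λ t → t * t * I b ℓ (suc p)) (ι-suc p) ⟨
  ι (suc p) * ι (suc p) * I b ℓ (suc p)    ≡⟨ cong (_* I b ℓ (suc p)) (ι-* (suc p) (suc p)) ⟨
  ι (suc p ℕ.* suc p) * I b ℓ (suc p)      ≡⟨ /-suc {∏ℤ p (I-factor b ℓ)} {k = I-factor b ℓ p} {m = suc p ℕ.* suc p} {{p ℕₚ.!* p !≢0}} {{suc p ℕₚ.!* suc p !≢0}} (∏ℤ-suc p (I-factor b ℓ)) (ℕₚ.[m*n]*[o*p]≡[m*o]*[n*p] (suc p) (p !) (suc p) (p !)) ⟩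
  I b ℓ p * fromℤ (I-factor b ℓ p)         ≡⟨ cong (I b ℓ p *_) (fromℤ-I-factor b ℓ p) ⟩
  I b ℓ p * (ι ℓ * ι ℓ - (ι b - ι p) * (ι b - ι p)) ∎

-- Starts at r^1, since J(b;r) has coefficients 0 at r^0 and 1 at r^1. The minus sign is the new
-- factor of (-1)^(p+1).
J-suc : ∀ b q → (1ℚ + (1ℚ + ι q)) * (1ℚ + ι q) * J b (suc (suc q)) ≡ J b (suc q) * - ((ι b - ι q) * (ι b - ι q - 1ℚ))
J-suc b q = begin
  (1ℚ + (1ℚ + ι q)) * (1ℚ + ι q) * J b (suc (suc q)) ≡⟨ cong (λ t → (1ℚ + t) * t * J b (suc (suc q))) (ι-suc q) ⟨
  (1ℚ + ι (suc q)) * ι (suc q) * J b (suc (suc q))   ≡⟨ cong (λ t → t * ι (suc q) * J b (suc (suc q))) (ι-suc (suc q)) ⟨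
  ι (suc (suc q)) * ι (suc q) * J b (suc (suc q))    ≡⟨ cong (_* J b (suc (suc q))) (ι-* (suc (suc q)) (suc q)) ⟨
  ι (suc (suc q) ℕ.* suc q) * J b (suc (suc q))      ≡⟨ /-suc {sign ℤ.* ∏ℤ q (J-factor b)} {k = ℤ.- J-factor b q} {m = suc (suc q) ℕ.* suc q} {{suc q ℕₚ.!* q !≢0}} {{suc (suc q) ℕₚ.!* suc q !≢0}} product (ℕₚ.[m*n]*[o*p]≡[m*o]*[n*p] (suc (suc q)) (suc q !) (suc q) (q !)) ⟩
  J b (suc q) * fromℤ (ℤ.- J-factor b q)             ≡⟨ cong (J b (suc q) *_) (trans (fromℤ-neg (J-factor b q)) (cong -_ (fromℤ-J-factor b q))) ⟩
  J b (suc q) * - ((ι b - ι q) * (ι b - ι q - 1ℚ))   ∎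
  where
  sign = ℤ.-1ℤ ℤ.^ (suc q ℕ.+ 1)
  product : ℤ.-1ℤ ℤ.* sign ℤ.* ∏ℤ (suc q) (J-factor b) ≡ sign ℤ.* ∏ℤ q (J-factor b) ℤ.* (ℤ.- J-factor b q)
  product = trans (cong (ℤ.-1ℤ ℤ.* sign ℤ.*_) (∏ℤ-suc q (J-factor b)))
    (ℤ-Solver.solve 3 (λ s t u → ℤ-Solver.con ℤ.-1ℤ ℤ-Solver.:* s ℤ-Solver.:* (t ℤ-Solver.:* u) ℤ-Solver.:= s ℤ-Solver.:* t ℤ-Solver.:* (ℤ-Solver.:- u)) refl sign (∏ℤ q (J-factor b)) (J-factor b q))

-- Contiguity in ℓ and the differential equation for I(b,ℓ;r).

1+ι-cancel : ∀ p {a c} → (1ℚ + ι p) * a ≡ (1ℚ + ι p) * c → a ≡ c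
1+ι-cancel p h = ι-cancel (suc p) (subst (λ t → t * _ ≡ t * _) (sym (ι-suc p)) h)

-- The product is (ℓ - b)(ℓ - b + 1)···(ℓ - b + p - 1) times (ℓ + b)(ℓ + b - 1)···(ℓ + b - p + 1);
-- replacing ℓ by ℓ + 1 drops one end factor of each run and adds one at the other end. The relation
-- is cross-multiplied because end factors can vanish.
I-shift : ∀ b ℓ p → (ι ℓ - ι b + ι p) * (1ℚ + ι ℓ + ι b) * I b ℓ p ≡ (ι ℓ - ι b) * (1ℚ + ι ℓ + ι b - ι p) * I b (suc ℓ) p
I-shift b ℓ zero = solve 2 (λ l b → (l :- b :+ con 0ℚ) :* (con 1ℚ :+ l :+ b) :* con 1ℚ := (l :- b) :* (con 1ℚ :+ l :+ b :- con 0ℚ) :* con 1ℚ) refl (ι ℓ) (ι b)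
I-shift b ℓ (suc p) = 1+ι-cancel p (1+ι-cancel p (begin
  (1ℚ + π) * ((1ℚ + π) * ((l - β + ι (suc p)) * (1ℚ + l + β) * I b ℓ (suc p)))
    ≡⟨ cong (λ t → (1ℚ + π) * ((1ℚ + π) * ((l - β + t) * (1ℚ + l + β) * I b ℓ (suc p)))) (ι-suc p) ⟩
  (1ℚ + π) * ((1ℚ + π) * ((l - β + (1ℚ + π)) * (1ℚ + l + β) * I b ℓ (suc p)))
    ≡⟨ solve 4 (λ l b p i → (con 1ℚ :+ p) :* ((con 1ℚ :+ p) :* ((l :- b :+ (con 1ℚ :+ p)) :* (con 1ℚ :+ l :+ b) :* i))
         := (l :- b :+ (con 1ℚ :+ p)) :* (con 1ℚ :+ l :+ b) :* ((con 1ℚ :+ p) :* (con 1ℚ :+ p) :* i)) refl l β π (I b ℓ (suc p)) ⟩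
  (l - β + (1ℚ + π)) * (1ℚ + l + β) * ((1ℚ + π) * (1ℚ + π) * I b ℓ (suc p))
    ≡⟨ cong ((l - β + (1ℚ + π)) * (1ℚ + l + β) *_) (I-suc b ℓ p) ⟩
  (l - β + (1ℚ + π)) * (1ℚ + l + β) * (I b ℓ p * (l * l - (β - π) * (β - π)))
    -- The factorisation ℓ² - (b - p)² = (ℓ + b - p)(ℓ - b + p) exposes the left side for p. After
    -- the induction hypothesis, (ℓ + 1 - b + p)(ℓ + 1 + b - p) is reassembled into the recurrence
    -- factor for ℓ + 1.
    ≡⟨ solve 4 (λ l b p i → (l :- b :+ (con 1ℚ :+ p)) :* (con 1ℚ :+ l :+ b) :* (i :* (l :* l :- (b :- p) :* (b :- p)))
         := (l :- b :+ (con 1ℚ :+ p)) :* (l :+ b :- p) :* ((l :- b :+ p) :* (con 1ℚ :+ l :+ b) :* i)) refl l β π (I b ℓ p) ⟩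
  (l - β + (1ℚ + π)) * (l + β - π) * ((l - β + π) * (1ℚ + l + β) * I b ℓ p)
    ≡⟨ cong ((l - β + (1ℚ + π)) * (l + β - π) *_) (I-shift b ℓ p) ⟩
  (l - β + (1ℚ + π)) * (l + β - π) * ((l - β) * (1ℚ + l + β - π) * I b (suc ℓ) p)
    ≡⟨ solve 4 (λ l b p i → (l :- b :+ (con 1ℚ :+ p)) :* (l :+ b :- p) :* ((l :- b) :* (con 1ℚ :+ l :+ b :- p) :* i)
         := (l :- b) :* (l :+ b :- p) :* (i :* ((con 1ℚ :+ l) :* (con 1ℚ :+ l) :- (b :- p) :* (b :- p)))) refl l β π (I b (suc ℓ) p) ⟩
  (l - β) * (l + β - π) * (I b (suc ℓ) p * ((1ℚ + l) * (1ℚ + l) - (β - π) * (β - π)))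
    ≡⟨ cong (λ t → (l - β) * (l + β - π) * (I b (suc ℓ) p * (t * t - (β - π) * (β - π)))) (ι-suc ℓ) ⟨
  (l - β) * (l + β - π) * (I b (suc ℓ) p * (ι (suc ℓ) * ι (suc ℓ) - (β - π) * (β - π)))
    ≡⟨ cong ((l - β) * (l + β - π) *_) (I-suc b (suc ℓ) p) ⟨
  (l - β) * (l + β - π) * ((1ℚ + π) * (1ℚ + π) * I b (suc ℓ) (suc p))
    ≡⟨ solve 4 (λ l b p i → (l :- b) :* (l :+ b :- p) :* ((con 1ℚ :+ p) :* (con 1ℚ :+ p) :* i)
         := (con 1ℚ :+ p) :* ((con 1ℚ :+ p) :* ((l :- b) :* (con 1ℚ :+ l :+ b :- (con 1ℚ :+ p)) :* i))) refl l β π (I b (suc ℓ) (suc p)) ⟩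
  (1ℚ + π) * ((1ℚ + π) * ((l - β) * (1ℚ + l + β - (1ℚ + π)) * I b (suc ℓ) (suc p)))
    ≡⟨ cong (λ t → (1ℚ + π) * ((1ℚ + π) * ((l - β) * (1ℚ + l + β - t) * I b (suc ℓ) (suc p)))) (ι-suc p) ⟨
  (1ℚ + π) * ((1ℚ + π) * ((l - β) * (1ℚ + l + β - ι (suc p)) * I b (suc ℓ) (suc p))) ∎))
  where
  l = ι ℓ
  β = ι b
  π = ι p

∑-telescope : ∀ n (f : ℕ → ℚ) → ∑ n (λ i → f (suc i) - f i) ≡ f n - f 0
∑-telescope zero    f = sym (ℚₚ.+-inverseʳ (f 0))
∑-telescope (suc n) f = trans (cong (f 1 - f 0 +_) (∑-telescope n (f ∘ suc)))
  (solve 3 (λ a b c → (b :- a) :+ (c :- b) := c :- a) refl (f 0) (f 1) (f (suc n)))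

∑-*ˡ : ∀ n c (f : ℕ → ℚ) → ∑ n (λ i → c * f i) ≡ c * ∑ n f
∑-*ˡ zero    c f = sym (ℚₚ.*-zeroʳ c)
∑-*ˡ (suc n) c f = trans (cong (c * f 0 +_) (∑-*ˡ n c (f ∘ suc))) (sym (ℚₚ.*-distribˡ-+ c (f 0) _))

∑2kI : ℕ → ℕ → ℕ → ℚ
∑2kI b n p = ∑ n (λ i → ι (2 ℕ.* suc i) * I b (suc i) p)

-- (1 + p) · ∑2kI b ℓ p is a telescoping sum with this antidifference in ℓ, which vanishes at ℓ = b.
antidiff : ℕ → ℕ → ℕ → ℚ
antidiff b p ℓ = (ι ℓ - ι b + ι p) * (1ℚ + ι ℓ + ι b) * I b ℓ p

-- `I-shift` turns the value at ℓ into a multiple of `I b (suc ℓ) p` as well; the two quadratic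
-- prefactors then differ by (1 + p) · 2(ℓ + 1).
antidiff-diff : ∀ b p ℓ → antidiff b p (suc ℓ) - antidiff b p ℓ ≡ (1ℚ + ι p) * (ι (2 ℕ.* suc ℓ) * I b (suc ℓ) p)
antidiff-diff b p ℓ = begin
  antidiff b p (suc ℓ) - antidiff b p ℓ
    ≡⟨ cong₂ (λ s t → (s - β + π) * (1ℚ + s + β) * I b (suc ℓ) p - t) (ι-suc ℓ) (I-shift b ℓ p) ⟩
  (1ℚ + l - β + π) * (1ℚ + (1ℚ + l) + β) * I b (suc ℓ) p - (l - β) * (1ℚ + l + β - π) * I b (suc ℓ) p
    ≡⟨ solve 4 (λ l b p i → (con 1ℚ :+ l :- b :+ p) :* (con 1ℚ :+ (con 1ℚ :+ l) :+ b) :* i :- (l :- b) :* (con 1ℚ :+ l :+ b :- p) :* i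
         := (con 1ℚ :+ p) :* (con (ι 2) :* (con 1ℚ :+ l) :* i)) refl l β π (I b (suc ℓ) p) ⟩
  (1ℚ + π) * (ι 2 * (1ℚ + l) * I b (suc ℓ) p)
    ≡⟨ cong (λ t → (1ℚ + π) * (t * I b (suc ℓ) p)) (trans (ι-* 2 (suc ℓ)) (cong (ι 2 *_) (ι-suc ℓ))) ⟨
  (1ℚ + π) * (ι (2 ℕ.* suc ℓ) * I b (suc ℓ) p) ∎
  where
  l = ι ℓ
  β = ι b
  π = ι p

-- The factor m = 0 of the product is ℓ² - b², so I(b,b;r) = 1. In the recurrence the zero enters at
-- p = 0 and is inherited afterwards.
I-diagonal : ∀ b p → I b b (suc p) ≡ 0ℚ
I-diagonal b p = 1+ι-cancel p (1+ι-cancel p (begin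
  (1ℚ + ι p) * ((1ℚ + ι p) * I b b (suc p))               ≡⟨ sym (ℚₚ.*-assoc (1ℚ + ι p) (1ℚ + ι p) _) ⟩
  (1ℚ + ι p) * (1ℚ + ι p) * I b b (suc p)                 ≡⟨ I-suc b b p ⟩
  I b b p * (ι b * ι b - (ι b - ι p) * (ι b - ι p))       ≡⟨ vanish p ⟩
  0ℚ                                                      ≡⟨ solve 1 (λ p → con 0ℚ := (con 1ℚ :+ p) :* ((con 1ℚ :+ p) :* con 0ℚ)) refl (ι p) ⟩
  (1ℚ + ι p) * ((1ℚ + ι p) * 0ℚ)                          ∎))
  where
  vanish : ∀ p → I b b p * (ι b * ι b - (ι b - ι p) * (ι b - ι p)) ≡ 0ℚ
  vanish zero    = solve 1 (λ b → con 1ℚ :* (b :* b :- (b :- con 0ℚ) :* (b :- con 0ℚ)) := con 0ℚ) refl (ι b)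
  vanish (suc p) = trans (cong (_* f) (I-diagonal b p)) (ℚₚ.*-zeroˡ f)
    where f = ι b * ι b - (ι b - ι (suc p)) * (ι b - ι (suc p))

antidiff-diagonal : ∀ b p → antidiff b p b ≡ 0ℚ
antidiff-diagonal b zero    = solve 1 (λ b → (b :- b :+ con 0ℚ) :* (con 1ℚ :+ b :+ b) :* con 1ℚ := con 0ℚ) refl (ι b)
antidiff-diagonal b (suc p) = trans (cong (c *_) (I-diagonal b p)) (ℚₚ.*-zeroʳ c)
  where c = (ι b - ι b + ι (suc p)) * (1ℚ + ι b + ι b)

∑2kI-antidiff : ∀ b n p → (1ℚ + ι p) * ∑2kI b n p ≡ antidiff b p n - antidiff b p 0
∑2kI-antidiff b n p = trans (sym (∑-*ˡ n (1ℚ + ι p) _))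
  (trans (∑-cong n (λ i → sym (antidiff-diff b p i))) (∑-telescope n (antidiff b p)))

-- The boundary values at 0 of the two telescoping sums cancel and the one at b is 0, so only
-- `antidiff b p ℓ` survives. What remains is (ℓ - b + p)(ℓ + b - p) + (1 + p)(p - b) = -(1 + p)ℓ +
-- (ℓ - b + p)(1 + ℓ + b).
I-ode : ∀ b ℓ p → ι (suc p) * I b ℓ (suc p) + ι p * I b ℓ p - ι b * I b ℓ p ≡ (- ι ℓ) * I b ℓ p + ∑2kI b ℓ p - ∑2kI b b p
I-ode b ℓ p = 1+ι-cancel p (begin
  (1ℚ + π) * (ι (suc p) * I b ℓ (suc p) + π * i - β * i)
    ≡⟨ cong (λ t → (1ℚ + π) * (t * I b ℓ (suc p) + π * i - β * i)) (ι-suc p) ⟩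
  (1ℚ + π) * ((1ℚ + π) * I b ℓ (suc p) + π * i - β * i)
    ≡⟨ solve 4 (λ b p i j → (con 1ℚ :+ p) :* ((con 1ℚ :+ p) :* j :+ p :* i :- b :* i) := (con 1ℚ :+ p) :* (con 1ℚ :+ p) :* j :+ (con 1ℚ :+ p) :* (p :* i :- b :* i)) refl β π i (I b ℓ (suc p)) ⟩
  (1ℚ + π) * (1ℚ + π) * I b ℓ (suc p) + (1ℚ + π) * (π * i - β * i)
    ≡⟨ cong (_+ (1ℚ + π) * (π * i - β * i)) (I-suc b ℓ p) ⟩
  i * (l * l - (β - π) * (β - π)) + (1ℚ + π) * (π * i - β * i)
    -- Here c is the boundary value at 0, inserted with both signs; the 0ℚ beside it becomes the
    -- value at b.
    ≡⟨ solve 5 (λ l b p i c → i :* (l :* l :- (b :- p) :* (b :- p)) :+ (con 1ℚ :+ p) :* (p :* i :- b :* i)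
         := (con 1ℚ :+ p) :* ((:- l) :* i) :+ ((l :- b :+ p) :* (con 1ℚ :+ l :+ b) :* i :- c) :- (con 0ℚ :- c)) refl l β π i (antidiff b p 0) ⟩
  (1ℚ + π) * ((- l) * i) + (antidiff b p ℓ - antidiff b p 0) - (0ℚ - antidiff b p 0)
    ≡⟨ cong (λ t → (1ℚ + π) * ((- l) * i) + (antidiff b p ℓ - antidiff b p 0) - (t - antidiff b p 0)) (antidiff-diagonal b p) ⟨
  (1ℚ + π) * ((- l) * i) + (antidiff b p ℓ - antidiff b p 0) - (antidiff b p b - antidiff b p 0)
    ≡⟨ cong₂ (λ s t → (1ℚ + π) * ((- l) * i) + s - t) (∑2kI-antidiff b ℓ p) (∑2kI-antidiff b b p) ⟨
  (1ℚ + π) * ((- l) * i) + (1ℚ + π) * ∑2kI b ℓ p - (1ℚ + π) * ∑2kI b b p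
    ≡⟨ solve 4 (λ p a s t → (con 1ℚ :+ p) :* a :+ (con 1ℚ :+ p) :* s :- (con 1ℚ :+ p) :* t := (con 1ℚ :+ p) :* (a :+ s :- t)) refl π ((- l) * i) (∑2kI b ℓ p) (∑2kI b b p) ⟩
  (1ℚ + π) * ((- l) * i + ∑2kI b ℓ p - ∑2kI b b p) ∎)
  where
  i = I b ℓ p
  l = ι ℓ
  β = ι b
  π = ι p

-- Relations between J(b;r), I(b,0;r) and I(b,1;r).

-- The hypothesis says ℓ ∈ {0, 1}.
I-via-J : ∀ b ℓ → ι ℓ * ι ℓ ≡ ι ℓ → ∀ q → (1ℚ + ι q) * I b ℓ (suc q) ≡ (- ((ι b + ι ℓ) * (ι b - ι q - ι ℓ))) * J b (suc q)
I-via-J b ℓ idem zero = begin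
  (1ℚ + 0ℚ) * I b ℓ 1            ≡⟨ solve 1 (λ i → (con 1ℚ :+ con 0ℚ) :* i := (con 1ℚ :+ con 0ℚ) :* (con 1ℚ :+ con 0ℚ) :* i) refl (I b ℓ 1) ⟩
  (1ℚ + 0ℚ) * (1ℚ + 0ℚ) * I b ℓ 1 ≡⟨ I-suc b ℓ 0 ⟩
  1ℚ * (ι ℓ * ι ℓ - (ι b - 0ℚ) * (ι b - 0ℚ))
    ≡⟨ solve 2 (λ l b → con 1ℚ :* (l :* l :- (b :- con 0ℚ) :* (b :- con 0ℚ)) := (:- ((b :+ l) :* (b :- con 0ℚ :- l))) :* con 1ℚ) refl (ι ℓ) (ι b) ⟩
  (- ((ι b + ι ℓ) * (ι b - 0ℚ - ι ℓ))) * 1ℚ ∎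
I-via-J b ℓ idem (suc q) = 1+ι-cancel q (1+ι-cancel (suc q) (begin
  (1ℚ + ι (suc q)) * ((1ℚ + π) * ((1ℚ + ι (suc q)) * I b ℓ (suc (suc q))))
    ≡⟨ solve 3 (λ s p i → s :* (p :* (s :* i)) := p :* (s :* s :* i)) refl (1ℚ + ι (suc q)) (1ℚ + π) (I b ℓ (suc (suc q))) ⟩
  (1ℚ + π) * ((1ℚ + ι (suc q)) * (1ℚ + ι (suc q)) * I b ℓ (suc (suc q)))
    ≡⟨ cong ((1ℚ + π) *_) (trans (I-suc b ℓ (suc q)) (cong (λ t → I b ℓ (suc q) * (l * l - (β - t) * (β - t))) (ι-suc q))) ⟩
  (1ℚ + π) * (I b ℓ (suc q) * (l * l - (β - (1ℚ + π)) * (β - (1ℚ + π))))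
    ≡⟨ sym (ℚₚ.*-assoc (1ℚ + π) _ _) ⟩
  (1ℚ + π) * I b ℓ (suc q) * (l * l - (β - (1ℚ + π)) * (β - (1ℚ + π)))
    ≡⟨ cong (_* (l * l - (β - (1ℚ + π)) * (β - (1ℚ + π)))) (I-via-J b ℓ idem q) ⟩
  (- ((β + l) * (β - π - l))) * j * (l * l - (β - (1ℚ + π)) * (β - (1ℚ + π)))
    -- Regrouping by (b - q - ℓ)(b - q - 1 + ℓ) = (b - q)(b - q - 1) + (ℓ - ℓ²): for idempotent ℓ
    -- this is the factor in the recurrence of `J`, up to sign.
    ≡⟨ solve 4 (λ l b p j → (:- ((b :+ l) :* (b :- p :- l))) :* j :* (l :* l :- (b :- (con 1ℚ :+ p)) :* (b :- (con 1ℚ :+ p)))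
         := (b :+ l) :* (b :- (con 1ℚ :+ p) :- l) :* ((b :- p) :* (b :- p :- con 1ℚ) :+ (l :- l :* l)) :* j) refl l β π j ⟩
  (β + l) * (β - (1ℚ + π) - l) * ((β - π) * (β - π - 1ℚ) + (l - l * l)) * j
    ≡⟨ cong (λ t → (β + l) * (β - (1ℚ + π) - l) * ((β - π) * (β - π - 1ℚ) + (l - t)) * j) idem ⟩
  (β + l) * (β - (1ℚ + π) - l) * ((β - π) * (β - π - 1ℚ) + (l - l)) * j
    ≡⟨ solve 4 (λ l b p j → (b :+ l) :* (b :- (con 1ℚ :+ p) :- l) :* ((b :- p) :* (b :- p :- con 1ℚ) :+ (l :- l)) :* j
         := (:- ((b :+ l) :* (b :- (con 1ℚ :+ p) :- l))) :* (j :* (:- ((b :- p) :* (b :- p :- con 1ℚ))))) refl l β π j ⟩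
  (- ((β + l) * (β - (1ℚ + π) - l))) * (j * - ((β - π) * (β - π - 1ℚ)))
    ≡⟨ cong ((- ((β + l) * (β - (1ℚ + π) - l))) *_) (J-suc b q) ⟨
  (- ((β + l) * (β - (1ℚ + π) - l))) * ((1ℚ + (1ℚ + π)) * (1ℚ + π) * J b (suc (suc q)))
    ≡⟨ solve 4 (λ c s p j → c :* (s :* p :* j) := s :* (p :* (c :* j))) refl (- ((β + l) * (β - (1ℚ + π) - l))) (1ℚ + (1ℚ + π)) (1ℚ + π) (J b (suc (suc q))) ⟩
  (1ℚ + (1ℚ + π)) * ((1ℚ + π) * ((- ((β + l) * (β - (1ℚ + π) - l))) * J b (suc (suc q))))
    ≡⟨ cong (λ t → (1ℚ + t) * ((1ℚ + π) * ((- ((β + l) * (β - t - l))) * J b (suc (suc q))))) (ι-suc q) ⟨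
  (1ℚ + ι (suc q)) * ((1ℚ + π) * ((- ((β + l) * (β - ι (suc q) - l))) * J b (suc (suc q)))) ∎))
  where
  j = J b (suc q)
  l = ι ℓ
  β = ι b
  π = ι q

-- By `I-via-J` both coefficients are multiples of `J b (suc q)`, and b(b - q) - (b + 1)(b - q - 1)
-- = 1 + q.
I₁-I₀ : ∀ b p → I b 1 p - I b 0 p ≡ J b p
I₁-I₀ b zero    = refl
I₁-I₀ b (suc q) = 1+ι-cancel q (begin
  (1ℚ + π) * (I b 1 (suc q) - I b 0 (suc q))
    ≡⟨ solve 3 (λ s i j → s :* (i :- j) := s :* i :- s :* j) refl (1ℚ + π) (I b 1 (suc q)) (I b 0 (suc q)) ⟩
  (1ℚ + π) * I b 1 (suc q) - (1ℚ + π) * I b 0 (suc q)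
    ≡⟨ cong₂ _-_ (I-via-J b 1 refl q) (I-via-J b 0 refl q) ⟩
  (- ((β + 1ℚ) * (β - π - 1ℚ))) * J b (suc q) - (- ((β + 0ℚ) * (β - π - 0ℚ))) * J b (suc q)
    ≡⟨ solve 3 (λ b p j → (:- ((b :+ con 1ℚ) :* (b :- p :- con 1ℚ))) :* j :- (:- ((b :+ con 0ℚ) :* (b :- p :- con 0ℚ))) :* j
         := (con 1ℚ :+ p) :* j) refl β π (J b (suc q)) ⟩
  (1ℚ + π) * J b (suc q) ∎)
  where
  β = ι b
  π = ι q

-- After `J-suc` there is a common factor b - q - 1 with cofactor -(b - q) - (1 + q) = -(b + 1);
-- their product is the multiplier that `I-via-J` gives at ℓ = 1.
J-ode : ∀ b p → ι (suc p) * J b (suc p) + ι p * J b p - ι b * J b p ≡ I b 1 p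
J-ode b zero    = solve 1 (λ b → con 1ℚ :* con 1ℚ :+ con 0ℚ :* con 0ℚ :- b :* con 0ℚ := con 1ℚ) refl (ι b)
J-ode b (suc q) = 1+ι-cancel q (begin
  (1ℚ + π) * (ι (suc (suc q)) * J b (suc (suc q)) + ι (suc q) * j - β * j)
    ≡⟨ cong₂ (λ s t → (1ℚ + π) * (s * J b (suc (suc q)) + t * j - β * j)) (trans (ι-suc (suc q)) (cong (1ℚ +_) (ι-suc q))) (ι-suc q) ⟩
  (1ℚ + π) * ((1ℚ + (1ℚ + π)) * J b (suc (suc q)) + (1ℚ + π) * j - β * j)
    ≡⟨ solve 5 (λ s t b j j′ → t :* (s :* j′ :+ t :* j :- b :* j) := s :* t :* j′ :+ t :* (t :* j :- b :* j)) refl (1ℚ + (1ℚ + π)) (1ℚ + π) β j (J b (suc (suc q))) ⟩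
  (1ℚ + (1ℚ + π)) * (1ℚ + π) * J b (suc (suc q)) + (1ℚ + π) * ((1ℚ + π) * j - β * j)
    ≡⟨ cong (_+ (1ℚ + π) * ((1ℚ + π) * j - β * j)) (J-suc b q) ⟩
  j * - ((β - π) * (β - π - 1ℚ)) + (1ℚ + π) * ((1ℚ + π) * j - β * j)
    ≡⟨ solve 3 (λ b p j → j :* (:- ((b :- p) :* (b :- p :- con 1ℚ))) :+ (con 1ℚ :+ p) :* ((con 1ℚ :+ p) :* j :- b :* j)
         := (:- ((b :+ con 1ℚ) :* (b :- p :- con 1ℚ))) :* j) refl β π j ⟩
  (- ((β + 1ℚ) * (β - π - 1ℚ))) * j
    ≡⟨ I-via-J b 1 refl q ⟨
  (1ℚ + π) * I b 1 (suc q) ∎)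
  where
  j = J b (suc q)
  β = ι b
  π = ι q

-- Rearranging finite sums.

∑-- : ∀ n (f g : ℕ → ℚ) → ∑ n (λ i → f i - g i) ≡ ∑ n f - ∑ n g
∑-- zero    f g = refl
∑-- (suc n) f g = trans (cong (f 0 - g 0 +_) (∑-- n (f ∘ suc) (g ∘ suc)))
  (solve 4 (λ a b c d → (a :- b) :+ (c :- d) := (a :+ c) :- (b :+ d)) refl (f 0) (g 0) _ _)

∑-swap : ∀ m n (f : ℕ → ℕ → ℚ) → ∑ m (λ i → ∑ n (f i)) ≡ ∑ n (λ j → ∑ m (λ i → f i j))
∑-swap zero    n f = sym (∑-zero n (λ _ → refl))
∑-swap (suc m) n f = trans (cong (∑ n (f 0) +_) (∑-swap m n (f ∘ suc)))
  (sym (∑-+ n (f 0) (λ j → ∑ m (λ i → f (suc i) j))))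

∑-single : ∀ {n k} (f : ℕ → ℚ) → k < n → (∀ i → i ≢ k → f i ≡ 0ℚ) → ∑ n f ≡ f k
∑-single {suc n} {zero}  f _       h = trans (cong (f 0 +_) (∑-zero n (λ i → h (suc i) (λ ())))) (ℚₚ.+-identityʳ (f 0))
∑-single {suc n} {suc k} f (s≤s p) h = trans
  (cong₂ _+_ (h 0 (λ ())) (∑-single (f ∘ suc) p (λ i i≢k → h (suc i) (i≢k ∘ ℕₚ.suc-injective))))
  (ℚₚ.+-identityˡ (f (suc k)))

-- Both sides run over the triples of sum n. Peeling off j = 0 leaves the statement for the
-- predecessor of n. This is the reindexing behind associativity of the Cauchy product.
∑-triangle : ∀ n (t : ℕ → ℕ → ℕ → ℚ) →
             ∑ (suc n) (λ i → ∑ (suc i) (λ j → t j (i ∸ j) (n ∸ i))) ≡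
             ∑ (suc n) (λ j → ∑ (suc (n ∸ j)) (λ k → t j k (n ∸ j ∸ k)))
∑-triangle zero    t = refl
∑-triangle (suc n) t = begin
  (t 0 0 (suc n) + 0ℚ) + ∑ (suc n) (λ i → t 0 (suc i) (n ∸ i) + ∑ (suc i) (λ j → t (suc j) (i ∸ j) (n ∸ i)))
    ≡⟨ cong₂ _+_ (ℚₚ.+-identityʳ (t 0 0 (suc n))) (∑-+ (suc n) (λ i → t 0 (suc i) (n ∸ i)) (λ i → ∑ (suc i) (λ j → t (suc j) (i ∸ j) (n ∸ i)))) ⟩
  t 0 0 (suc n) + (row + ∑ (suc n) (λ i → ∑ (suc i) (λ j → t (suc j) (i ∸ j) (n ∸ i))))
    ≡⟨ sym (ℚₚ.+-assoc (t 0 0 (suc n)) row _) ⟩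
  (t 0 0 (suc n) + row) + ∑ (suc n) (λ i → ∑ (suc i) (λ j → t (suc j) (i ∸ j) (n ∸ i)))
    ≡⟨ cong (t 0 0 (suc n) + row +_) (∑-triangle n (t ∘ suc)) ⟩
  (t 0 0 (suc n) + row) + ∑ (suc n) (λ j → ∑ (suc (n ∸ j)) (λ k → t (suc j) k (n ∸ j ∸ k))) ∎
  where
  row = ∑ (suc n) (λ i → t 0 (suc i) (n ∸ i))

-- The product rule in one variable, from N = i + (N - i); the terms i = 0 and i = N each have
-- weight zero in one of the two sums.
∑-leibniz : ∀ N (T : ℕ → ℚ) → ι N * ∑ (suc N) T ≡ ∑ N (λ i → ι (suc i) * T (suc i)) + ∑ N (λ i → ι (N ∸ i) * T i)
∑-leibniz N T = begin
  ι N * ∑ (suc N) T                                                      ≡⟨ sym (∑-*ˡ (suc N) (ι N) T) ⟩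
  ∑ (suc N) (λ i → ι N * T i)                                            ≡⟨ ∑-cong< (suc N) weight ⟩
  ∑ (suc N) (λ i → ι i * T i + ι (N ∸ i) * T i)                          ≡⟨ ∑-+ (suc N) (λ i → ι i * T i) (λ i → ι (N ∸ i) * T i) ⟩
  ∑ (suc N) (λ i → ι i * T i) + ∑ (suc N) (λ i → ι (N ∸ i) * T i)        ≡⟨ cong₂ _+_ first last ⟩
  ∑ N (λ i → ι (suc i) * T (suc i)) + ∑ N (λ i → ι (N ∸ i) * T i)        ∎
  where
  weight : ∀ i → i < suc N → ι N * T i ≡ ι i * T i + ι (N ∸ i) * T i
  weight i (s≤s i≤N) = trans
    (cong (_* T i) (trans (cong ι (sym (ℕₚ.m+[n∸m]≡n i≤N))) (ι-+ i (N ∸ i))))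
    (ℚₚ.*-distribʳ-+ (T i) (ι i) (ι (N ∸ i)))
  first : ∑ (suc N) (λ i → ι i * T i) ≡ ∑ N (λ i → ι (suc i) * T (suc i))
  first = trans (cong (_+ rest) (ℚₚ.*-zeroˡ (T 0))) (ℚₚ.+-identityˡ rest)
    where rest = ∑ N (λ i → ι (suc i) * T (suc i))
  last : ∑ (suc N) (λ i → ι (N ∸ i) * T i) ≡ ∑ N (λ i → ι (N ∸ i) * T i)
  last = ∑-extend (ℕₚ.n≤1+n N) (λ i N≤i → trans (cong (λ t → ι t * T i) (ℕₚ.m≤n⇒m∸n≡0 N≤i)) (ℚₚ.*-zeroˡ (T i)))

-- Algebra of the Cauchy product on coefficient functions.

mul-scaleˡ : ∀ μ c f g → mul (λ α → c * f α) g μ ≡ c * mul f g μ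
mul-scaleˡ []      c f g = ℚₚ.*-assoc c (f []) (g [])
mul-scaleˡ (n ∷ μ) c f g = trans
  (∑-cong (suc n) (λ i → mul-scaleˡ μ c (λ α → f (i ∷ α)) (λ α → g (n ∸ i ∷ α))))
  (∑-*ˡ (suc n) c (λ i → mul (λ α → f (i ∷ α)) (λ α → g (n ∸ i ∷ α)) μ))

mul-scaleʳ : ∀ μ c f g → mul f (λ α → c * g α) μ ≡ c * mul f g μ
mul-scaleʳ μ c f g = trans (mul-comm μ f _) (trans (mul-scaleˡ μ c g f) (cong (c *_) (mul-comm μ g f)))

mul-distribˡ : ∀ μ f g h → mul f (λ α → g α + h α) μ ≡ mul f g μ + mul f h μ
mul-distribˡ μ f g h = trans (mul-comm μ f _)
  (trans (mul-distribʳ μ g h f) (cong₂ _+_ (mul-comm μ g f) (mul-comm μ h f)))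

mul-distribˡ-- : ∀ μ f g h → mul f (λ α → g α - h α) μ ≡ mul f g μ - mul f h μ
mul-distribˡ-- μ f g h = begin
  mul f (λ α → g α - h α) μ              ≡⟨ mul-cong μ f _ f _ (λ {α} {β} _ → cong (f α *_) (minus (g β) (h β))) ⟩
  mul f (λ α → g α + (- 1ℚ) * h α) μ     ≡⟨ mul-distribˡ μ f g _ ⟩
  mul f g μ + mul f (λ α → (- 1ℚ) * h α) μ ≡⟨ cong (mul f g μ +_) (mul-scaleʳ μ (- 1ℚ) f h) ⟩
  mul f g μ + (- 1ℚ) * mul f h μ         ≡⟨ minus (mul f g μ) (mul f h μ) ⟨
  mul f g μ - mul f h μ                  ∎
  where
  minus : ∀ a b → a - b ≡ a + (- 1ℚ) * b
  minus = solve 2 (λ a b → a :- b := a :+ con (- 1ℚ) :* b) refl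

mul-zeroʳ : ∀ μ f → mul f (λ _ → 0ℚ) μ ≡ 0ℚ
mul-zeroʳ μ f = trans (mul-comm μ f _) (mul-zeroˡ μ f)

mul-∑ʳ : ∀ μ n f (g : ℕ → Mon → ℚ) → mul f (λ α → ∑ n (λ i → g i α)) μ ≡ ∑ n (λ i → mul f (g i) μ)
mul-∑ʳ μ zero    f g = mul-zeroʳ μ f
mul-∑ʳ μ (suc n) f g = trans (mul-distribˡ μ f (g 0) _) (cong (mul f (g 0) μ +_) (mul-∑ʳ μ n f (g ∘ suc)))

mul-∑ˡ : ∀ μ n (f : ℕ → Mon → ℚ) g → mul (λ α → ∑ n (λ i → f i α)) g μ ≡ ∑ n (λ i → mul (f i) g μ)
mul-∑ˡ μ n f g = trans (mul-comm μ _ g) (trans (mul-∑ʳ μ n g f) (∑-cong n (λ i → mul-comm μ g (f i))))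

mul-assoc : ∀ μ f g h → mul (mul f g) h μ ≡ mul f (mul g h) μ
mul-assoc []      f g h = ℚₚ.*-assoc (f []) (g []) (h [])
mul-assoc (n ∷ μ) f g h = begin
  ∑ (suc n) (λ i → mul (λ α → ∑ (suc i) (λ j → mul (f′ j) (g′ (i ∸ j)) α)) (h′ (n ∸ i)) μ)
    ≡⟨ ∑-cong (suc n) (λ i → mul-∑ˡ μ (suc i) (λ j → mul (f′ j) (g′ (i ∸ j))) (h′ (n ∸ i))) ⟩
  ∑ (suc n) (λ i → ∑ (suc i) (λ j → mul (mul (f′ j) (g′ (i ∸ j))) (h′ (n ∸ i)) μ))
    ≡⟨ ∑-cong (suc n) (λ i → ∑-cong (suc i) (λ j → mul-assoc μ (f′ j) (g′ (i ∸ j)) (h′ (n ∸ i)))) ⟩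
  ∑ (suc n) (λ i → ∑ (suc i) (λ j → mul (f′ j) (mul (g′ (i ∸ j)) (h′ (n ∸ i))) μ))
    ≡⟨ ∑-triangle n (λ j k l → mul (f′ j) (mul (g′ k) (h′ l)) μ) ⟩
  ∑ (suc n) (λ j → ∑ (suc (n ∸ j)) (λ k → mul (f′ j) (mul (g′ k) (h′ (n ∸ j ∸ k))) μ))
    ≡⟨ ∑-cong (suc n) (λ j → mul-∑ʳ μ (suc (n ∸ j)) (f′ j) (λ k → mul (g′ k) (h′ (n ∸ j ∸ k)))) ⟨
  ∑ (suc n) (λ j → mul (f′ j) (λ α → ∑ (suc (n ∸ j)) (λ k → mul (g′ k) (h′ (n ∸ j ∸ k)) α)) μ) ∎
  where
  f′ g′ h′ : ℕ → Mon → ℚ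
  f′ i α = f (i ∷ α)
  g′ i α = g (i ∷ α)
  h′ i α = h (i ∷ α)

mul-constˡ : ∀ μ c f → mul (constCoeff c) f μ ≡ c * f μ
mul-constˡ []      c f = refl
mul-constˡ (n ∷ μ) c f = trans
  (cong₂ _+_ (mul-constˡ μ c (λ α → f (n ∷ α))) (∑-zero n (λ i → mul-zeroˡ μ (λ α → f (n ∸ suc i ∷ α)))))
  (ℚₚ.+-identityʳ _)

mul-constʳ : ∀ μ c f → mul f (constCoeff c) μ ≡ c * f μ
mul-constʳ μ c f = trans (mul-comm μ f _) (mul-constˡ μ c f)

-- Partial derivatives and the product rule.

-- ∂ on bare coefficient functions: the recursion below passes to slices
-- λ α → f (i ∷ α), which carry no proof of Respects.
∂Coeff : ℕ → (Mon → ℚ) → Mon → ℚ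
∂Coeff k f μ = ι (suc (exponent μ k)) * f (inc k μ)

-- The bound on k keeps `inc k` from lengthening the list; otherwise values at [] and at 0 ∷ []
-- would be compared, which may differ for bare functions. For a `Series`, `pad` supplies the bound.
∂Coeff-mul : ∀ k μ f g → k < length μ → ∂Coeff k (mul f g) μ ≡ mul (∂Coeff k f) g μ + mul f (∂Coeff k g) μ
∂Coeff-mul zero (n ∷ μ) f g _ = trans (∑-leibniz (suc n) T) (cong₂ _+_
  (∑-cong (suc n) (λ i → sym (mul-scaleˡ μ (ι (suc i)) (f′ (suc i)) (g′ (n ∸ i)))))
  (∑-cong< (suc n) λ i i≤n → trans
    (cong (λ t → ι t * mul (f′ i) (g′ t) μ) (ℕₚ.+-∸-assoc 1 (ℕ.s≤s⁻¹ i≤n)))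
    (sym (mul-scaleʳ μ (ι (suc (n ∸ i))) (f′ i) (g′ (suc (n ∸ i)))))))
  where
  f′ g′ : ℕ → Mon → ℚ
  f′ i α = f (i ∷ α)
  g′ i α = g (i ∷ α)
  T : ℕ → ℚ
  T i = mul (f′ i) (g′ (suc n ∸ i)) μ
∂Coeff-mul (suc k) (n ∷ μ) f g (s≤s k<) = begin
  c * ∑ (suc n) (λ i → mul (f′ i) (g′ (n ∸ i)) (inc k μ))     ≡⟨ ∑-*ˡ (suc n) c (λ i → mul (f′ i) (g′ (n ∸ i)) (inc k μ)) ⟨
  ∑ (suc n) (λ i → ∂Coeff k (mul (f′ i) (g′ (n ∸ i))) μ)      ≡⟨ ∑-cong (suc n) (λ i → ∂Coeff-mul k μ (f′ i) (g′ (n ∸ i)) k<) ⟩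
  ∑ (suc n) (λ i → mul (∂Coeff k (f′ i)) (g′ (n ∸ i)) μ + mul (f′ i) (∂Coeff k (g′ (n ∸ i))) μ)
    ≡⟨ ∑-+ (suc n) (λ i → mul (∂Coeff k (f′ i)) (g′ (n ∸ i)) μ) (λ i → mul (f′ i) (∂Coeff k (g′ (n ∸ i))) μ) ⟩
  ∑ (suc n) (λ i → mul (∂Coeff k (f′ i)) (g′ (n ∸ i)) μ) + ∑ (suc n) (λ i → mul (f′ i) (∂Coeff k (g′ (n ∸ i))) μ) ∎
  where
  c = ι (suc (exponent μ k))
  f′ g′ : ℕ → Mon → ℚ
  f′ i α = f (i ∷ α)
  g′ i α = g (i ∷ α)

pad : ℕ → Mon → Mon
pad zero    []      = 0 ∷ []
pad zero    (n ∷ μ) = n ∷ μ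
pad (suc k) []      = 0 ∷ pad k []
pad (suc k) (n ∷ μ) = n ∷ pad k μ

pad-length : ∀ k μ → k < length (pad k μ)
pad-length zero    []      = s≤s z≤n
pad-length zero    (n ∷ μ) = s≤s z≤n
pad-length (suc k) []      = s≤s (pad-length k [])
pad-length (suc k) (n ∷ μ) = s≤s (pad-length k μ)

pad-≋ : ∀ k μ → μ ≋ pad k μ
pad-≋ zero    []      = []≋0∷[]
pad-≋ zero    (n ∷ μ) j = refl
pad-≋ (suc k) []      zero    = refl
pad-≋ (suc k) []      (suc j) = pad-≋ k [] j
pad-≋ (suc k) (n ∷ μ) = ≋-cons n {μ} {pad k μ} (pad-≋ k μ)

∂-* : ∀ k F G → ∂ k (F *ˢ G) ≈ ∂ k F *ˢ G +ˢ F *ˢ ∂ k G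
∂-* k F G μ = begin
  coeff (∂ k (F *ˢ G)) μ                        ≡⟨ coeff-≋ (∂ k (F *ˢ G)) μ (pad k μ) (pad-≋ k μ) ⟩
  coeff (∂ k (F *ˢ G)) (pad k μ)                ≡⟨ ∂Coeff-mul k (pad k μ) (coeff F) (coeff G) (pad-length k μ) ⟩
  coeff (∂ k F *ˢ G +ˢ F *ˢ ∂ k G) (pad k μ)    ≡⟨ coeff-≋ (∂ k F *ˢ G +ˢ F *ˢ ∂ k G) μ (pad k μ) (pad-≋ k μ) ⟨
  coeff (∂ k F *ˢ G +ˢ F *ˢ ∂ k G) μ            ∎

constCoeff-inc : ∀ c k μ → constCoeff c (inc k μ) ≡ 0ℚ
constCoeff-inc c zero    []          = refl
constCoeff-inc c zero    (n ∷ μ)     = refl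
constCoeff-inc c (suc k) []          = constCoeff-inc c k []
constCoeff-inc c (suc k) (zero ∷ μ)  = constCoeff-inc c k μ
constCoeff-inc c (suc k) (suc n ∷ μ) = refl

∂-const : ∀ k c μ → coeff (∂ k (const c)) μ ≡ 0ℚ
∂-const k c μ = trans (cong (ι (suc (exponent μ k)) *_) (constCoeff-inc c k μ)) (ℚₚ.*-zeroʳ (ι (suc (exponent μ k))))

∂-x-same : ∀ k → ∂ k (x k) ≈ 1ˢ
∂-x-same zero    []          = refl
∂-x-same zero    (zero ∷ μ)  = ℚₚ.*-identityˡ (constCoeff 1ℚ μ)
∂-x-same zero    (suc n ∷ μ) = ℚₚ.*-zeroʳ (ι (suc (suc n)))
∂-x-same (suc k) []          = ∂-x-same k []
∂-x-same (suc k) (zero ∷ μ)  = ∂-x-same k μ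
∂-x-same (suc k) (suc n ∷ μ) = ℚₚ.*-zeroʳ (ι (suc (exponent μ k)))

varCoeff-inc : ∀ k ℓ μ → ℓ ≢ k → varCoeff ℓ (inc k μ) ≡ 0ℚ
varCoeff-inc zero    zero    μ                 h = contradiction refl h
varCoeff-inc zero    (suc ℓ) []                h = refl
varCoeff-inc zero    (suc ℓ) (n ∷ μ)           h = refl
varCoeff-inc (suc k) zero    []                h = refl
varCoeff-inc (suc k) zero    (zero ∷ μ)        h = refl
varCoeff-inc (suc k) zero    (suc zero ∷ μ)    h = constCoeff-inc 1ℚ k μ
varCoeff-inc (suc k) zero    (suc (suc n) ∷ μ) h = refl
varCoeff-inc (suc k) (suc ℓ) []                h = varCoeff-inc k ℓ [] (h ∘ cong suc)
varCoeff-inc (suc k) (suc ℓ) (zero ∷ μ)        h = varCoeff-inc k ℓ μ (h ∘ cong suc)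
varCoeff-inc (suc k) (suc ℓ) (suc n ∷ μ)       h = refl

∂-x-other : ∀ k ℓ μ → ℓ ≢ k → coeff (∂ k (x ℓ)) μ ≡ 0ℚ
∂-x-other k ℓ μ h = trans (cong (ι (suc (exponent μ k)) *_) (varCoeff-inc k ℓ μ h)) (ℚₚ.*-zeroʳ (ι (suc (exponent μ k))))

-- The sums Σ x_ℓ F_ℓ, and cancellation.

length-inc : ∀ k μ → (k < length (inc k μ)) × (length μ ≤ length (inc k μ))
length-inc zero    []      = s≤s z≤n , z≤n
length-inc zero    (n ∷ μ) = s≤s z≤n , ℕₚ.≤-refl
length-inc (suc k) []      with p , q ← length-inc k [] = s≤s p , z≤n
length-inc (suc k) (n ∷ μ) with p , q ← length-inc k μ  = s≤s p , s≤s q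

degree-inc : ∀ k μ → degree (inc k μ) ≡ suc (degree μ)
degree-inc zero    []      = refl
degree-inc zero    (n ∷ μ) = refl
degree-inc (suc k) []      = degree-inc k []
degree-inc (suc k) (n ∷ μ) = trans (cong (n ℕ.+_) (degree-inc k μ)) (ℕₚ.+-suc n (degree μ))

split-length : ∀ {μ α β} → Split μ α β → length β ≡ length μ
split-length []      = refl
split-length (_ ∷ s) = cong suc (split-length s)

split-degreeʳ : ∀ {μ α β} → Split μ α β → degree β ≤ degree μ
split-degreeʳ {α = α} s = ℕₚ.≤-trans (ℕₚ.m≤n+m _ (degree α)) (ℕₚ.≤-reflexive (split-degree s))

*ˢ-congʳ : ∀ A {F G} → F ≈ G → A *ˢ F ≈ A *ˢ G
*ˢ-congʳ A h μ = mul-cong μ _ _ _ _ (λ {α} {β} _ → cong (coeff A α *_) (h β))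

*ˢ-congˡ : ∀ A {F G} → F ≈ G → F *ˢ A ≈ G *ˢ A
*ˢ-congˡ A h μ = mul-cong μ _ _ _ _ (λ {α} {β} _ → cong (_* coeff A β) (h α))

∑x-cong : ∀ {F G} → (∀ ℓ → F ℓ ≈ G ℓ) → ∑x F ≈ ∑x G
∑x-cong {F} {G} h μ = ∑-cong (length μ) (λ ℓ → *ˢ-congʳ (x ℓ) {F ℓ} {G ℓ} (h ℓ) μ)

∑x-+ : ∀ F G → ∑x (λ ℓ → F ℓ +ˢ G ℓ) ≈ ∑x F +ˢ ∑x G
∑x-+ F G μ = trans (∑-cong (length μ) (λ ℓ → mul-distribˡ μ (varCoeff ℓ) (coeff (F ℓ)) (coeff (G ℓ))))
  (∑-+ (length μ) (λ ℓ → coeff (x ℓ *ˢ F ℓ) μ) (λ ℓ → coeff (x ℓ *ˢ G ℓ) μ))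

∑x-- : ∀ F G → ∑x (λ ℓ → F ℓ -ˢ G ℓ) ≈ ∑x F -ˢ ∑x G
∑x-- F G μ = trans (∑-cong (length μ) (λ ℓ → mul-distribˡ-- μ (varCoeff ℓ) (coeff (F ℓ)) (coeff (G ℓ))))
  (∑-- (length μ) (λ ℓ → coeff (x ℓ *ˢ F ℓ) μ) (λ ℓ → coeff (x ℓ *ˢ G ℓ) μ))

∑x-• : ∀ c F → ∑x (λ ℓ → c • F ℓ) ≈ c • ∑x F
∑x-• c F μ = trans (∑-cong (length μ) (λ ℓ → mul-scaleʳ μ c (varCoeff ℓ) (coeff (F ℓ))))
  (∑-*ˡ (length μ) c (λ ℓ → coeff (x ℓ *ˢ F ℓ) μ))

-- The truncation of `∑x` depends only on the length of the monomial, and the parts of a `Split` are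
-- as long as μ, so one bound serves the whole product.
*ˢ-∑x : ∀ A F → A *ˢ ∑x F ≈ ∑x (λ ℓ → A *ˢ F ℓ)
*ˢ-∑x A F μ = begin
  mul a (∑xCoeff F) μ
    ≡⟨ mul-cong μ a _ a _ (λ {α} {β} s → cong (λ n → a α * ∑ n (λ ℓ → coeff (x ℓ *ˢ F ℓ) β)) (split-length s)) ⟩
  mul a (λ β → ∑ (length μ) (λ ℓ → coeff (x ℓ *ˢ F ℓ) β)) μ
    ≡⟨ mul-∑ʳ μ (length μ) a (λ ℓ → coeff (x ℓ *ˢ F ℓ)) ⟩
  ∑ (length μ) (λ ℓ → mul a (mul (varCoeff ℓ) (coeff (F ℓ))) μ)
    ≡⟨ ∑-cong (length μ) exchange ⟩
  ∑ (length μ) (λ ℓ → mul (varCoeff ℓ) (mul a (coeff (F ℓ))) μ) ∎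
  where
  a = coeff A
  exchange : ∀ ℓ → mul a (mul (varCoeff ℓ) (coeff (F ℓ))) μ ≡ mul (varCoeff ℓ) (mul a (coeff (F ℓ))) μ
  exchange ℓ = begin
    mul a (mul (varCoeff ℓ) (coeff (F ℓ))) μ   ≡⟨ mul-assoc μ a (varCoeff ℓ) (coeff (F ℓ)) ⟨
    coeff ((A *ˢ x ℓ) *ˢ F ℓ) μ                ≡⟨ *ˢ-congˡ (F ℓ) {A *ˢ x ℓ} {x ℓ *ˢ A} (*ˢ-comm A (x ℓ)) μ ⟩
    coeff ((x ℓ *ˢ A) *ˢ F ℓ) μ                ≡⟨ mul-assoc μ (varCoeff ℓ) a (coeff (F ℓ)) ⟩
    mul (varCoeff ℓ) (mul a (coeff (F ℓ))) μ   ∎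

-- The term F k comes from differentiating x_k itself. The truncation belonging to `inc k μ`
-- contains the index k even when μ is too short for it; its surplus terms in the other sum vanish
-- by `x-vanish`.
∂-∑x : ∀ k F → ∂ k (∑x F) ≈ F k +ˢ ∑x (λ ℓ → ∂ k (F ℓ))
∂-∑x k F μ = begin
  ι (suc (exponent μ k)) * ∑ N (λ ℓ → coeff (x ℓ *ˢ F ℓ) (inc k μ))
    ≡⟨ sym (∑-*ˡ N (ι (suc (exponent μ k))) (λ ℓ → coeff (x ℓ *ˢ F ℓ) (inc k μ))) ⟩
  ∑ N (λ ℓ → coeff (∂ k (x ℓ *ˢ F ℓ)) μ)
    ≡⟨ ∑-cong N (λ ℓ → ∂-* k (x ℓ) (F ℓ) μ) ⟩
  ∑ N (λ ℓ → coeff (∂ k (x ℓ) *ˢ F ℓ) μ + coeff (x ℓ *ˢ ∂ k (F ℓ)) μ)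
    ≡⟨ ∑-+ N (λ ℓ → coeff (∂ k (x ℓ) *ˢ F ℓ) μ) _ ⟩
  ∑ N (λ ℓ → coeff (∂ k (x ℓ) *ˢ F ℓ) μ) + ∑ N (λ ℓ → coeff (x ℓ *ˢ ∂ k (F ℓ)) μ)
    ≡⟨ cong₂ _+_ only (∑-extend len≤ (λ ℓ → x-vanish ℓ (∂ k (F ℓ)) μ)) ⟩
  coeff (F k) μ + ∑xCoeff (λ ℓ → ∂ k (F ℓ)) μ ∎
  where
  N = length (inc k μ)
  k<N : k < N
  k<N with p , _ ← length-inc k μ = p
  len≤ : length μ ≤ N
  len≤ with _ , q ← length-inc k μ = q
  only : ∑ N (λ ℓ → coeff (∂ k (x ℓ) *ˢ F ℓ) μ) ≡ coeff (F k) μ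
  only = begin
    ∑ N (λ ℓ → coeff (∂ k (x ℓ) *ˢ F ℓ) μ)
      ≡⟨ ∑-single (λ ℓ → coeff (∂ k (x ℓ) *ˢ F ℓ) μ) k<N (λ ℓ ℓ≢k → mul-vanish μ _ _ λ {α} {β} _ →
           trans (cong (_* coeff (F ℓ) β) (∂-x-other k ℓ α ℓ≢k)) (ℚₚ.*-zeroˡ (coeff (F ℓ) β))) ⟩
    coeff (∂ k (x k) *ˢ F k) μ  ≡⟨ *ˢ-congˡ (F k) {∂ k (x k)} {1ˢ} (∂-x-same k) μ ⟩
    coeff (1ˢ *ˢ F k) μ         ≡⟨ mul-identityˡ μ (coeff (F k)) ⟩
    coeff (F k) μ               ∎

-- Induction on the degree through F = A F - (A - 1) F: as A - 1 has no constant term, (A - 1) F in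
-- a given degree involves F only in lower degrees.
*ˢ-cancelˡ : ∀ A F G → constantTerm A ≡ 1ℚ → A *ˢ F ≈ A *ˢ G → F ≈ G
*ˢ-cancelˡ A F G A₀ h μ = agree (suc (degree μ)) μ ℕₚ.≤-refl
  where
  A-1 = A -ˢ 1ˢ
  recover : ∀ F ν → coeff F ν ≡ coeff (A *ˢ F) ν - coeff (A-1 *ˢ F) ν
  recover F ν = trans (solve 2 (λ a b → a := a :+ b :- b) refl (coeff F ν) (coeff (A-1 *ˢ F) ν))
    (cong (_- coeff (A-1 *ˢ F) ν) (sym (*ˢ-split1 A F ν)))
  agree : ∀ n → Agree n F G
  agree zero    ν ()
  agree (suc n) ν p = trans (recover F ν) (trans
    (cong₂ _-_ (h ν) (mul-agree⁺ {n} {A-1} {F} {G} (cong (_- 1ℚ) A₀) (agree n) ν p))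
    (sym (recover G ν)))

-- Powers of R and the substitution r := R.

∂-^ : ∀ k R p → ∂ k (R ^ˢ suc p) ≈ ι (suc p) • (R ^ˢ p *ˢ ∂ k R)
∂-^ k R zero μ = begin
  coeff (∂ k (R *ˢ 1ˢ)) μ                           ≡⟨ ∂-* k R 1ˢ μ ⟩
  coeff (∂ k R *ˢ 1ˢ) μ + coeff (R *ˢ ∂ k 1ˢ) μ     ≡⟨ cong₂ _+_ (*ˢ-comm (∂ k R) 1ˢ μ) (mul-vanish μ _ _ λ {α} {β} _ → trans (cong (coeff R α *_) (∂-const k 1ℚ β)) (ℚₚ.*-zeroʳ (coeff R α))) ⟩
  coeff (1ˢ *ˢ ∂ k R) μ + 0ℚ                        ≡⟨ solve 1 (λ a → a :+ con 0ℚ := con 1ℚ :* a) refl (coeff (1ˢ *ˢ ∂ k R) μ) ⟩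
  1ℚ * coeff (1ˢ *ˢ ∂ k R) μ                        ∎
∂-^ k R (suc p) μ = begin
  coeff (∂ k (R *ˢ S)) μ                            ≡⟨ ∂-* k R S μ ⟩
  coeff (∂ k R *ˢ S) μ + coeff (R *ˢ ∂ k S) μ       ≡⟨ cong₂ _+_ (*ˢ-comm (∂ k R) S μ) second ⟩
  t + ι (suc p) * t                                 ≡⟨ solve 2 (λ c t → t :+ c :* t := (con 1ℚ :+ c) :* t) refl (ι (suc p)) t ⟩
  (1ℚ + ι (suc p)) * t                              ≡⟨ cong (_* t) (ι-suc (suc p)) ⟨
  ι (suc (suc p)) * t                               ∎
  where
  S = R ^ˢ suc p
  t = coeff (S *ˢ ∂ k R) μ
  second : coeff (R *ˢ ∂ k S) μ ≡ ι (suc p) * t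
  second = begin
    coeff (R *ˢ ∂ k S) μ                                ≡⟨ *ˢ-congʳ R {∂ k S} {ι (suc p) • (R ^ˢ p *ˢ ∂ k R)} (∂-^ k R p) μ ⟩
    coeff (R *ˢ (ι (suc p) • (R ^ˢ p *ˢ ∂ k R))) μ      ≡⟨ mul-scaleʳ μ (ι (suc p)) (coeff R) (coeff (R ^ˢ p *ˢ ∂ k R)) ⟩
    ι (suc p) * coeff (R *ˢ (R ^ˢ p *ˢ ∂ k R)) μ        ≡⟨ cong (ι (suc p) *_) (sym (mul-assoc μ (coeff R) (coeff (R ^ˢ p)) (coeff (∂ k R)))) ⟩
    ι (suc p) * t                                       ∎

-- Coefficients of a′(r) and r a′(r) for a(r) = Σ_p a_p r^p.
deriv euler : (ℕ → ℚ) → ℕ → ℚ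
deriv a p = ι (suc p) * a (suc p)
euler a p = ι p * a p

module Composition (R : Series) (R₀ : constantTerm R ≡ 0ℚ) where

  -- Comparison with the zero series: each further factor R, having no constant term, raises the
  -- order by one.
  ^-order : ∀ p μ → degree μ < p → coeff (R ^ˢ p) μ ≡ 0ℚ
  ^-order (suc p) μ d<p = trans
    (mul-agree⁺ {p} {R} {R ^ˢ p} {0ˢ} R₀ (λ ν q → trans (^-order p ν q) (sym (constCoeff-0 ν))) μ d<p)
    (trans (mul-constʳ μ 0ℚ (coeff R)) (ℚₚ.*-zeroˡ (coeff R μ)))

  compose : (ℕ → ℚ) → Series
  compose a = series (λ μ → ∑ (suc (degree μ)) (λ p → a p * coeff (R ^ˢ p) μ)) resp
    where
    resp : Respects (λ μ → ∑ (suc (degree μ)) (λ p → a p * coeff (R ^ˢ p) μ))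
    resp α β h rewrite degree-≋ α β h = ∑-cong (suc (degree β)) (λ p → cong (a p *_) (coeff-≋ (R ^ˢ p) α β h))

  compose-partial : ∀ {n} a μ → degree μ < n → coeff (compose a) μ ≡ ∑ n (λ p → a p * coeff (R ^ˢ p) μ)
  compose-partial a μ d<n = sym (∑-extend d<n (λ p d<p → trans (cong (a p *_) (^-order p μ d<p)) (ℚₚ.*-zeroʳ (a p))))

  -- A factor of μ has degree at most that of μ, so `compose-partial` lets all factors share the
  -- bound given by μ.
  mul-compose : ∀ f a μ → mul f (coeff (compose a)) μ ≡ ∑ (suc (degree μ)) (λ p → a p * mul f (coeff (R ^ˢ p)) μ)
  mul-compose f a μ = begin
    mul f (coeff (compose a)) μ
      ≡⟨ mul-cong μ f _ f _ (λ {α} {β} s → cong (f α *_) (compose-partial a β (s≤s (split-degreeʳ s)))) ⟩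
    mul f (λ β → ∑ (suc (degree μ)) (λ p → a p * coeff (R ^ˢ p) β)) μ
      ≡⟨ mul-∑ʳ μ (suc (degree μ)) f (λ p β → a p * coeff (R ^ˢ p) β) ⟩
    ∑ (suc (degree μ)) (λ p → mul f (λ β → a p * coeff (R ^ˢ p) β) μ)
      ≡⟨ ∑-cong (suc (degree μ)) (λ p → mul-scaleʳ μ (a p) f (coeff (R ^ˢ p))) ⟩
    ∑ (suc (degree μ)) (λ p → a p * mul f (coeff (R ^ˢ p)) μ) ∎

  compose-cong : ∀ {a c} → (∀ p → a p ≡ c p) → compose a ≈ compose c
  compose-cong h μ = ∑-cong (suc (degree μ)) (λ p → cong (_* coeff (R ^ˢ p) μ) (h p))

  compose-+ : ∀ a c → compose (λ p → a p + c p) ≈ compose a +ˢ compose c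
  compose-+ a c μ = trans (∑-cong (suc (degree μ)) (λ p → ℚₚ.*-distribʳ-+ (coeff (R ^ˢ p) μ) (a p) (c p)))
    (∑-+ (suc (degree μ)) (λ p → a p * coeff (R ^ˢ p) μ) (λ p → c p * coeff (R ^ˢ p) μ))

  compose-- : ∀ a c → compose (λ p → a p - c p) ≈ compose a -ˢ compose c
  compose-- a c μ = trans
    (∑-cong (suc (degree μ)) (λ p → solve 3 (λ a c r → (a :- c) :* r := a :* r :- c :* r) refl (a p) (c p) (coeff (R ^ˢ p) μ)))
    (∑-- (suc (degree μ)) (λ p → a p * coeff (R ^ˢ p) μ) (λ p → c p * coeff (R ^ˢ p) μ))

  compose-• : ∀ c a → compose (λ p → c * a p) ≈ c • compose a
  compose-• c a μ = trans (∑-cong (suc (degree μ)) (λ p → ℚₚ.*-assoc c (a p) (coeff (R ^ˢ p) μ)))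
    (∑-*ˡ (suc (degree μ)) c (λ p → a p * coeff (R ^ˢ p) μ))

  compose-∑ : ∀ n (a : ℕ → ℕ → ℚ) → compose (λ p → ∑ n (λ i → a i p)) ≈ ∑ˢ n (λ i → compose (a i))
  compose-∑ zero    a μ = ∑-zero (suc (degree μ)) (λ p → ℚₚ.*-zeroˡ (coeff (R ^ˢ p) μ))
  compose-∑ (suc n) a μ = trans (compose-+ (a 0) (λ p → ∑ n (λ i → a (suc i) p)) μ)
    (cong (coeff (compose (a 0)) μ +_) (compose-∑ n (a ∘ suc) μ))

  *ˢ-compose-deriv : ∀ a → R *ˢ compose (deriv a) ≈ compose (euler a)
  *ˢ-compose-deriv a μ = begin
    mul (coeff R) (coeff (compose (deriv a))) μ                  ≡⟨ mul-compose (coeff R) (deriv a) μ ⟩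
    rest                                                         ≡⟨ ℚₚ.+-identityˡ rest ⟨
    -- The factor R shifts the index by one. The missing term p = 0 of r a′ is zero, and
    -- `compose-partial` absorbs the one surplus term at the top.
    0ℚ + rest                                                    ≡⟨ cong (_+ rest) (solve 2 (λ a r → con 0ℚ := con 0ℚ :* a :* r) refl (a 0) (coeff (R ^ˢ 0) μ)) ⟩
    ∑ (suc (suc (degree μ))) (λ p → euler a p * coeff (R ^ˢ p) μ) ≡⟨ compose-partial (euler a) μ (ℕₚ.m<n⇒m<1+n ℕₚ.≤-refl) ⟨
    coeff (compose (euler a)) μ                                  ∎
    where rest = ∑ (suc (degree μ)) (λ p → deriv a p * coeff (R ^ˢ suc p) μ)

  ∂-compose : ∀ k a → ∂ k (compose a) ≈ ∂ k R *ˢ compose (deriv a)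
  ∂-compose k a μ = begin
    c * coeff (compose a) (inc k μ)
      -- The degree of `inc k μ` is one higher; the additional term makes up for p = 0, which
      -- differentiation kills.
      ≡⟨ cong (c *_) (compose-partial a (inc k μ) (s≤s (ℕₚ.≤-reflexive (degree-inc k μ)))) ⟩
    c * ∑ (suc n) (λ p → a p * coeff (R ^ˢ p) (inc k μ))
      ≡⟨ ∑-*ˡ (suc n) c (λ p → a p * coeff (R ^ˢ p) (inc k μ)) ⟨
    ∑ (suc n) (λ p → c * (a p * coeff (R ^ˢ p) (inc k μ)))
      ≡⟨ ∑-cong (suc n) (λ p → solve 3 (λ c a r → c :* (a :* r) := a :* (c :* r)) refl c (a p) (coeff (R ^ˢ p) (inc k μ))) ⟩
    a 0 * coeff (∂ k 1ˢ) μ + ∑ n (λ p → a (suc p) * coeff (∂ k (R ^ˢ suc p)) μ)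
      ≡⟨ cong₂ _+_ (trans (cong (a 0 *_) (∂-const k 1ℚ μ)) (ℚₚ.*-zeroʳ (a 0))) (∑-cong n term) ⟩
    0ℚ + ∑ n (λ p → deriv a p * coeff (∂ k R *ˢ R ^ˢ p) μ)
      ≡⟨ ℚₚ.+-identityˡ _ ⟩
    ∑ n (λ p → deriv a p * coeff (∂ k R *ˢ R ^ˢ p) μ)
      ≡⟨ mul-compose (coeff (∂ k R)) (deriv a) μ ⟨
    coeff (∂ k R *ˢ compose (deriv a)) μ ∎
    where
    c = ι (suc (exponent μ k))
    n = suc (degree μ)
    term : ∀ p → a (suc p) * coeff (∂ k (R ^ˢ suc p)) μ ≡ deriv a p * coeff (∂ k R *ˢ R ^ˢ p) μ
    term p = begin
      a (suc p) * coeff (∂ k (R ^ˢ suc p)) μ                  ≡⟨ cong (a (suc p) *_) (∂-^ k R p μ) ⟩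
      a (suc p) * (ι (suc p) * coeff (R ^ˢ p *ˢ ∂ k R) μ)     ≡⟨ cong (λ t → a (suc p) * (ι (suc p) * t)) (*ˢ-comm (R ^ˢ p) (∂ k R) μ) ⟩
      a (suc p) * (ι (suc p) * coeff (∂ k R *ˢ R ^ˢ p) μ)     ≡⟨ solve 3 (λ a i t → a :* (i :* t) := i :* a :* t) refl (a (suc p)) (ι (suc p)) _ ⟩
      deriv a p * coeff (∂ k R *ˢ R ^ˢ p) μ                   ∎

  -- At a fixed monomial the sums over p and ℓ are finite with independent bounds, so they can be
  -- exchanged.
  eval-Ž : ∀ b → eval (Ž b) R ≈ compose (J b) -ˢ ∑x (λ ℓ → compose (I b ℓ))
  eval-Ž b μ = begin
    ∑ n (λ p → coeff (Ž b p *ˢ R ^ˢ p) μ)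
      ≡⟨ ∑-cong n term ⟩
    ∑ n (λ p → J b p * coeff (R ^ˢ p) μ - ∑ N (λ ℓ → I b ℓ p * coeff (x ℓ *ˢ R ^ˢ p) μ))
      ≡⟨ ∑-- n (λ p → J b p * coeff (R ^ˢ p) μ) (λ p → ∑ N (λ ℓ → I b ℓ p * coeff (x ℓ *ˢ R ^ˢ p) μ)) ⟩
    coeff (compose (J b)) μ - ∑ n (λ p → ∑ N (λ ℓ → I b ℓ p * coeff (x ℓ *ˢ R ^ˢ p) μ))
      ≡⟨ cong (λ t → coeff (compose (J b)) μ - t) (∑-swap n N (λ p ℓ → I b ℓ p * coeff (x ℓ *ˢ R ^ˢ p) μ)) ⟩
    coeff (compose (J b)) μ - ∑ N (λ ℓ → ∑ n (λ p → I b ℓ p * coeff (x ℓ *ˢ R ^ˢ p) μ))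
      ≡⟨ cong (λ t → coeff (compose (J b)) μ - t) (∑-cong N (λ ℓ → mul-compose (varCoeff ℓ) (I b ℓ) μ)) ⟨
    coeff (compose (J b)) μ - coeff (∑x (λ ℓ → compose (I b ℓ))) μ ∎
    where
    n = suc (degree μ)
    N = length μ
    term : ∀ p → coeff (Ž b p *ˢ R ^ˢ p) μ ≡ J b p * coeff (R ^ˢ p) μ - ∑ N (λ ℓ → I b ℓ p * coeff (x ℓ *ˢ R ^ˢ p) μ)
    term p = begin
      coeff (Ž b p *ˢ P) μ                                          ≡⟨ *ˢ-comm (Ž b p) P μ ⟩
      coeff (P *ˢ Ž b p) μ                                          ≡⟨ mul-distribˡ-- μ (coeff P) (constCoeff (J b p)) (∑xCoeff K) ⟩
      coeff (P *ˢ const (J b p)) μ - coeff (P *ˢ ∑x K) μ            ≡⟨ cong₂ _-_ (mul-constʳ μ (J b p) (coeff P)) (*ˢ-∑x P K μ) ⟩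
      J b p * coeff P μ - ∑ N (λ ℓ → coeff (x ℓ *ˢ (P *ˢ K ℓ)) μ)   ≡⟨ cong (λ t → J b p * coeff P μ - t) (∑-cong N scale) ⟩
      J b p * coeff P μ - ∑ N (λ ℓ → I b ℓ p * coeff (x ℓ *ˢ P) μ)  ∎
      where
      P = R ^ˢ p
      K : ℕ → Series
      K ℓ = const (I b ℓ p)
      scale : ∀ ℓ → coeff (x ℓ *ˢ (P *ˢ K ℓ)) μ ≡ I b ℓ p * coeff (x ℓ *ˢ P) μ
      scale ℓ = trans
        (*ˢ-congʳ (x ℓ) {P *ˢ K ℓ} {I b ℓ p • P} (λ ν → mul-constʳ ν (I b ℓ p) (coeff P)) μ)
        (mul-scaleʳ μ (I b ℓ p) (varCoeff ℓ) (coeff P))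

-- Implicit differentiation and the two operators.

module _ (b : ℕ) (R : Series) (isŘ : IsŘ b R) where

  open Composition R (constantTerm≡0 isŘ)

  -- ∂Ž/∂r at r = R.
  W : Series
  W = compose (deriv (J b)) -ˢ ∑x (λ ℓ → compose (deriv (I b ℓ)))

  -- By computation: J(b;r) has coefficient 1 at r^1, and `∑x` has no terms at the empty monomial.
  W-constantTerm : constantTerm W ≡ 1ℚ
  W-constantTerm = refl

  Ž∘R≈0 : ∀ μ → coeff (compose (J b)) μ - coeff (∑x (λ ℓ → compose (I b ℓ))) μ ≡ 0ℚ
  Ž∘R≈0 μ = trans (sym (eval-Ž b μ)) (trans (root isŘ μ) (constCoeff-0 μ))

  -- Implicit differentiation of Ž(R; x) = 0 with respect to x_k.
  W*∂R : ∀ k → W *ˢ ∂ k R ≈ compose (I b k)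
  W*∂R k μ = begin
    coeff (W *ˢ ∂ k R) μ
      ≡⟨ *ˢ-comm W (∂ k R) μ ⟩
    coeff (∂ k R *ˢ W) μ
      ≡⟨ mul-distribˡ-- μ (coeff (∂ k R)) (coeff (compose (deriv (J b)))) (coeff (∑x (λ ℓ → compose (deriv (I b ℓ))))) ⟩
    coeff (∂ k R *ˢ compose (deriv (J b))) μ - coeff (∂ k R *ˢ ∑x (λ ℓ → compose (deriv (I b ℓ)))) μ
      ≡⟨ cong₂ _-_ (sym (∂-compose k (J b) μ)) (*ˢ-∑x (∂ k R) (λ ℓ → compose (deriv (I b ℓ))) μ) ⟩
    ∂J - coeff (∑x (λ ℓ → ∂ k R *ˢ compose (deriv (I b ℓ)))) μ
      ≡⟨ cong (λ t → ∂J - t) (∑x-cong {λ ℓ → ∂ k (compose (I b ℓ))} {λ ℓ → ∂ k R *ˢ compose (deriv (I b ℓ))} (λ ℓ → ∂-compose k (I b ℓ)) μ) ⟨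
    ∂J - ∂I
      ≡⟨ solve 3 (λ j i c → j :- i := (j :- (c :+ i)) :+ c) refl ∂J ∂I (coeff (compose (I b k)) μ) ⟩
    -- The bracket is the total derivative of Ž(R; x), hence zero; what is left over is the explicit
    -- dependence on x_k.
    (∂J - (coeff (compose (I b k)) μ + ∂I)) + coeff (compose (I b k)) μ
      ≡⟨ cong (λ t → ∂J - t + coeff (compose (I b k)) μ) (∂-∑x k (λ ℓ → compose (I b ℓ)) μ) ⟨
    (∂J - c * s) + coeff (compose (I b k)) μ
      ≡⟨ cong (_+ coeff (compose (I b k)) μ) root′ ⟩
    0ℚ + coeff (compose (I b k)) μ
      ≡⟨ ℚₚ.+-identityˡ _ ⟩
    coeff (compose (I b k)) μ ∎
    where
    c = ι (suc (exponent μ k))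
    s = coeff (∑x (λ ℓ → compose (I b ℓ))) (inc k μ)
    ∂J = coeff (∂ k (compose (J b))) μ
    ∂I = coeff (∑x (λ ℓ → ∂ k (compose (I b ℓ)))) μ
    root′ : ∂J - c * s ≡ 0ℚ
    root′ = begin
      ∂J - c * s                                  ≡⟨ solve 3 (λ c j s → c :* j :- c :* s := c :* (j :- s)) refl c (coeff (compose (J b)) (inc k μ)) s ⟩
      c * (coeff (compose (J b)) (inc k μ) - s)   ≡⟨ cong (c *_) (Ž∘R≈0 (inc k μ)) ⟩
      c * 0ℚ                                      ≡⟨ ℚₚ.*-zeroʳ c ⟩
      0ℚ                                          ∎

  W*Ddil : W *ˢ Ddil R ≈ W *ˢ 0ˢ
  W*Ddil μ = begin
    coeff (W *ˢ Ddil R) μ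
      ≡⟨ mul-distribˡ-- μ (coeff W) (coeff (∂ 1 R -ˢ ∂ 0 R)) (coeff (∑x (λ ℓ → ∂ ℓ R))) ⟩
    coeff (W *ˢ (∂ 1 R -ˢ ∂ 0 R)) μ - coeff (W *ˢ ∑x (λ ℓ → ∂ ℓ R)) μ
      ≡⟨ cong₂ _-_ (mul-distribˡ-- μ (coeff W) (coeff (∂ 1 R)) (coeff (∂ 0 R))) (*ˢ-∑x W (λ ℓ → ∂ ℓ R) μ) ⟩
    coeff (W *ˢ ∂ 1 R) μ - coeff (W *ˢ ∂ 0 R) μ - coeff (∑x (λ ℓ → W *ˢ ∂ ℓ R)) μ
      ≡⟨ cong₂ _-_ (cong₂ _-_ (W*∂R 1 μ) (W*∂R 0 μ)) (∑x-cong {λ ℓ → W *ˢ ∂ ℓ R} {λ ℓ → compose (I b ℓ)} W*∂R μ) ⟩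
    coeff (compose (I b 1)) μ - coeff (compose (I b 0)) μ - coeff (∑x (λ ℓ → compose (I b ℓ))) μ
      ≡⟨ cong (_- coeff (∑x (λ ℓ → compose (I b ℓ))) μ) (trans (sym (compose-- (I b 1) (I b 0) μ)) (compose-cong (I₁-I₀ b) μ)) ⟩
    coeff (compose (J b)) μ - coeff (∑x (λ ℓ → compose (I b ℓ))) μ
      ≡⟨ Ž∘R≈0 μ ⟩
    0ℚ
      ≡⟨ trans (mul-constʳ μ 0ℚ (coeff W)) (ℚₚ.*-zeroˡ (coeff W μ)) ⟨
    coeff (W *ˢ 0ˢ) μ ∎

  W*∑2k∂ : ∀ n → W *ˢ ∑2k∂ n R ≈ compose (∑2kI b n)
  W*∑2k∂ n μ = begin
    coeff (W *ˢ ∑2k∂ n R) μ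
      ≡⟨ mul-∑ʳ μ n (coeff W) (λ i → coeff (ι (2 ℕ.* suc i) • ∂ (suc i) R)) ⟩
    ∑ n (λ i → coeff (W *ˢ (ι (2 ℕ.* suc i) • ∂ (suc i) R)) μ)
      ≡⟨ ∑-cong n (λ i → trans (mul-scaleʳ μ (ι (2 ℕ.* suc i)) (coeff W) (coeff (∂ (suc i) R)))
           (trans (cong (ι (2 ℕ.* suc i) *_) (W*∂R (suc i) μ)) (sym (compose-• (ι (2 ℕ.* suc i)) (I b (suc i)) μ)))) ⟩
    ∑ n (λ i → coeff (compose (λ p → ι (2 ℕ.* suc i) * I b (suc i) p)) μ)
      ≡⟨ compose-∑ n (λ i p → ι (2 ℕ.* suc i) * I b (suc i) p) μ ⟨
    coeff (compose (∑2kI b n)) μ ∎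

  -- The operator (1 + r) a′ - b a is the same in the equations for J and for every I(b,ℓ), so after
  -- substitution the pieces recombine into that operator applied to Ž.
  compose-ode : ∀ a → compose (λ p → deriv a p + euler a p - ι b * a p) ≈ compose (deriv a) +ˢ compose (euler a) -ˢ ι b • compose a
  compose-ode a μ = trans (compose-- (λ p → deriv a p + euler a p) (λ p → ι b * a p) μ)
    (cong₂ _-_ (compose-+ (deriv a) (euler a) μ) (compose-• (ι b) a μ))

  strTerm : ℕ → Series
  strTerm ℓ = (- ι ℓ) • ∂ ℓ R +ˢ ∑2k∂ ℓ R -ˢ ∑2k∂ b R

  W*strTerm : ∀ ℓ → W *ˢ strTerm ℓ ≈ compose (deriv (I b ℓ)) +ˢ compose (euler (I b ℓ)) -ˢ ι b • compose (I b ℓ)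
  W*strTerm ℓ μ = begin
    coeff (W *ˢ strTerm ℓ) μ
      ≡⟨ mul-distribˡ-- μ (coeff W) (coeff ((- ι ℓ) • ∂ ℓ R +ˢ ∑2k∂ ℓ R)) (coeff (∑2k∂ b R)) ⟩
    coeff (W *ˢ ((- ι ℓ) • ∂ ℓ R +ˢ ∑2k∂ ℓ R)) μ - coeff (W *ˢ ∑2k∂ b R) μ
      ≡⟨ cong (_- coeff (W *ˢ ∑2k∂ b R) μ) (mul-distribˡ μ (coeff W) (coeff ((- ι ℓ) • ∂ ℓ R)) (coeff (∑2k∂ ℓ R))) ⟩
    coeff (W *ˢ ((- ι ℓ) • ∂ ℓ R)) μ + coeff (W *ˢ ∑2k∂ ℓ R) μ - coeff (W *ˢ ∑2k∂ b R) μ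
      ≡⟨ cong₂ _-_ (cong₂ _+_ first (W*∑2k∂ ℓ μ)) (W*∑2k∂ b μ) ⟩
    coeff (compose (λ p → (- ι ℓ) * I b ℓ p)) μ + coeff (compose (∑2kI b ℓ)) μ - coeff (compose (∑2kI b b)) μ
      ≡⟨ trans (compose-- (λ p → (- ι ℓ) * I b ℓ p + ∑2kI b ℓ p) (∑2kI b b) μ)
           (cong (_- coeff (compose (∑2kI b b)) μ) (compose-+ (λ p → (- ι ℓ) * I b ℓ p) (∑2kI b ℓ) μ)) ⟨
    coeff (compose (λ p → (- ι ℓ) * I b ℓ p + ∑2kI b ℓ p - ∑2kI b b p)) μ
      ≡⟨ compose-cong (I-ode b ℓ) μ ⟨
    coeff (compose (λ p → deriv (I b ℓ) p + euler (I b ℓ) p - ι b * I b ℓ p)) μ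
      ≡⟨ compose-ode (I b ℓ) μ ⟩
    coeff (compose (deriv (I b ℓ)) +ˢ compose (euler (I b ℓ)) -ˢ ι b • compose (I b ℓ)) μ ∎
    where
    first : coeff (W *ˢ ((- ι ℓ) • ∂ ℓ R)) μ ≡ coeff (compose (λ p → (- ι ℓ) * I b ℓ p)) μ
    first = trans (mul-scaleʳ μ (- ι ℓ) (coeff W) (coeff (∂ ℓ R)))
      (trans (cong ((- ι ℓ) *_) (W*∂R ℓ μ)) (sym (compose-• (- ι ℓ) (I b ℓ) μ)))

  W*Dstr : W *ˢ Dstr b R ≈ W *ˢ (1ˢ +ˢ R)
  W*Dstr μ = begin
    coeff (W *ˢ Dstr b R) μ
      ≡⟨ mul-distribˡ-- μ (coeff W) (coeff (∂ 1 R)) (coeff (∑x strTerm)) ⟩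
    coeff (W *ˢ ∂ 1 R) μ - coeff (W *ˢ ∑x strTerm) μ
      ≡⟨ cong₂ _-_ partial₁ sumPart ⟩
    (J′ + θJ - ι b * j) - (I′ + θI - ι b * i)
      ≡⟨ solve 7 (λ J′ θJ j I′ θI i b → (J′ :+ θJ :- b :* j) :- (I′ :+ θI :- b :* i) := ((J′ :- I′) :+ (θJ :- θI)) :- b :* (j :- i)) refl J′ θJ j I′ θI i (ι b) ⟩
    ((J′ - I′) + (θJ - θI)) - ι b * (j - i)
      ≡⟨ cong (λ t → ((J′ - I′) + (θJ - θI)) - ι b * t) (Ž∘R≈0 μ) ⟩
    ((J′ - I′) + (θJ - θI)) - ι b * 0ℚ
      ≡⟨ solve 2 (λ t b → t :- b :* con 0ℚ := t) refl ((J′ - I′) + (θJ - θI)) (ι b) ⟩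
    -- J′ - I′ is the coefficient of W by definition, and θJ - θI is that of R W.
    coeff W μ + (θJ - θI)
      ≡⟨ cong₂ _+_ (*ˢ-identityʳ W μ) W*R ⟨
    coeff (W *ˢ 1ˢ) μ + coeff (W *ˢ R) μ
      ≡⟨ mul-distribˡ μ (coeff W) (coeff 1ˢ) (coeff R) ⟨
    coeff (W *ˢ (1ˢ +ˢ R)) μ ∎
    where
    j  = coeff (compose (J b)) μ
    J′ = coeff (compose (deriv (J b))) μ
    θJ = coeff (compose (euler (J b))) μ
    i  = coeff (∑x (λ ℓ → compose (I b ℓ))) μ
    I′ = coeff (∑x (λ ℓ → compose (deriv (I b ℓ)))) μ
    θI = coeff (∑x (λ ℓ → compose (euler (I b ℓ)))) μ
    partial₁ : coeff (W *ˢ ∂ 1 R) μ ≡ J′ + θJ - ι b * j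
    partial₁ = trans (W*∂R 1 μ) (trans (sym (compose-cong (J-ode b) μ)) (compose-ode (J b) μ))
    sumPart : coeff (W *ˢ ∑x strTerm) μ ≡ I′ + θI - ι b * i
    sumPart = begin
      coeff (W *ˢ ∑x strTerm) μ            ≡⟨ *ˢ-∑x W strTerm μ ⟩
      coeff (∑x (λ ℓ → W *ˢ strTerm ℓ)) μ
        ≡⟨ ∑x-cong {λ ℓ → W *ˢ strTerm ℓ} {λ ℓ → compose (deriv (I b ℓ)) +ˢ compose (euler (I b ℓ)) -ˢ ι b • compose (I b ℓ)} W*strTerm μ ⟩
      coeff (∑x (λ ℓ → compose (deriv (I b ℓ)) +ˢ compose (euler (I b ℓ)) -ˢ ι b • compose (I b ℓ))) μ
        ≡⟨ ∑x-- (λ ℓ → compose (deriv (I b ℓ)) +ˢ compose (euler (I b ℓ))) (λ ℓ → ι b • compose (I b ℓ)) μ ⟩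
      coeff (∑x (λ ℓ → compose (deriv (I b ℓ)) +ˢ compose (euler (I b ℓ)))) μ - coeff (∑x (λ ℓ → ι b • compose (I b ℓ))) μ
        ≡⟨ cong₂ _-_ (∑x-+ (λ ℓ → compose (deriv (I b ℓ))) (λ ℓ → compose (euler (I b ℓ))) μ) (∑x-• (ι b) (λ ℓ → compose (I b ℓ)) μ) ⟩
      I′ + θI - ι b * i ∎
    W*R : coeff (W *ˢ R) μ ≡ θJ - θI
    W*R = begin
      coeff (W *ˢ R) μ ≡⟨ *ˢ-comm W R μ ⟩
      coeff (R *ˢ W) μ ≡⟨ mul-distribˡ-- μ (coeff R) (coeff (compose (deriv (J b)))) (coeff (∑x (λ ℓ → compose (deriv (I b ℓ))))) ⟩
      coeff (R *ˢ compose (deriv (J b))) μ - coeff (R *ˢ ∑x (λ ℓ → compose (deriv (I b ℓ)))) μ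
        ≡⟨ cong₂ _-_ (*ˢ-compose-deriv (J b) μ) (*ˢ-∑x R (λ ℓ → compose (deriv (I b ℓ))) μ) ⟩
      θJ - coeff (∑x (λ ℓ → R *ˢ compose (deriv (I b ℓ)))) μ
        ≡⟨ cong (λ t → θJ - t) (∑x-cong {λ ℓ → R *ˢ compose (deriv (I b ℓ))} {λ ℓ → compose (euler (I b ℓ))} (λ ℓ → *ˢ-compose-deriv (I b ℓ)) μ) ⟩
      θJ - θI ∎

lemma19 : (b : ℕ) → (Dstr b (Ř b) ≈ 1ˢ +ˢ Ř b) × (Ddil (Ř b) ≈ 0ˢ)
lemma19 b =
    *ˢ-cancelˡ W′ (Dstr b (Ř b)) (1ˢ +ˢ Ř b) W′₀ (W*Dstr b (Ř b) (Ř-isŘ b))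
  , *ˢ-cancelˡ W′ (Ddil (Ř b)) 0ˢ W′₀ (W*Ddil b (Ř b) (Ř-isŘ b))
  where
  W′ = W b (Ř b) (Ř-isŘ b)
  W′₀ = W-constantTerm b (Ř b) (Ř-isŘ b)
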